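{- For every integer $n\ge 0$, let $a(n)$ denote the number of square-free words of length $n$ over the three-letter alphabet $\{0,1,2\}$. Then $a(n)\ge 2^{n/17}$ for every $n$, and hence the limit $\mu:=\lim_{n\to\infty} a(n)^{1/n}$ satisfies $\mu\ge 2^{1/17}$.
   Context: A word is a finite sequence of letters. A word is square-free if it cannot be written as a concatenation $a\,x\,x\,b$ with $a,b$ (possibly empty) words and $x$ a non-empty word. The empty word is the unique word of length $0$ and is square-free, so $a(0)=1$; the next values are $a(1)=3$, $a(2)=6$, $a(3)=12$, $a(4)=18$, $a(5)=30$, $a(6)=42$. The limit $\mu$ exists because $a(m+n)\le a(m)a(n)$ for all $m,n$ (Fekete's lemma). -}

module Defs where

open import Data.Nat.Base as ℕ using (ℕ; zero; suc)
open import Data.Fin.Base using (Fin; toℕ; fromℕ<)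
open import Data.Fin.Properties as Fin using (toℕ-fromℕ<)
open import Data.Integer.Base as ℤ using ()
open import Data.List.Base
  using (List; []; _∷_; _++_; length; filter; take; drop; allFin; cartesianProductWith)
open import Data.List.Properties as List using (≡-dec; take++drop≡id; ∷-injective)
open import Data.Product using (∃; ∃-syntax; _×_; _,_; proj₁; proj₂)
open import Data.Rational.Base as ℚ using (ℚ; 0ℚ; 1ℚ)
import Data.Rational.Properties as ℚ
open import Data.Sum.Base using (_⊎_; inj₁; inj₂)
import Data.Nat.Properties as ℕ
open import Function.Base using (_∘_)
open import Relation.Binary.Definitions using (tri<; tri≈; tri>)
open import Relation.Binary.PropositionalEquality
  using (_≡_; _≢_; refl; sym; trans; cong; cong₂; subst; subst₂)
open import Relation.Nullary using (¬_; Dec; yes; no; contradiction)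
open import Relation.Nullary.Decidable using (map′; ¬?; _⊎-dec_)
open import Relation.Unary using (Decidable)

open import Algebra.Definitions.RawSemiring ℚ.+-*-rawSemiring public
  using () renaming (_^_ to _^ℚ_)

------------------------------------------------------------------------
-- Square-free words over a three-letter alphabet

Letter : Set
Letter = Fin 3

Word : Set
Word = List Letter

ContainsSquare : Word → Set
ContainsSquare w = ∃[ a ] ∃[ x ] ∃[ b ] (x ≢ [] × w ≡ a ++ x ++ x ++ b)

SquareFree : Word → Set
SquareFree w = ¬ ContainsSquare w

private
  StartsWithSquare : Word → Set
  StartsWithSquare w = ∃[ x ] ∃[ b ] (x ≢ [] × w ≡ x ++ x ++ b)

  take-length : ∀ (x y : Word) → take (length x) (x ++ y) ≡ x
  take-length []      y = refl
  take-length (c ∷ x) y = cong (c ∷_) (take-length x y)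

  drop-length : ∀ (x y : Word) → drop (length x) (x ++ y) ≡ y
  drop-length []      y = refl
  drop-length (_ ∷ x) y = drop-length x y

  SquareAt : Word → ℕ → Set
  SquareAt w k = take (suc k) (drop (suc k) w) ≡ take (suc k) w

  squareAt⇒ : ∀ w (k : Fin (length w)) → SquareAt w (toℕ k) → StartsWithSquare w
  squareAt⇒ w@(c ∷ w′) k eq =
    take m w , drop m (drop m w) , (λ ()) ,
    sym (trans (cong (λ z → take m w ++ z ++ drop m (drop m w)) (sym eq))
        (trans (cong (take m w ++_) (take++drop≡id m (drop m w)))
               (take++drop≡id m w)))
    where m = suc (toℕ k)

  ⇒squareAt : ∀ w → StartsWithSquare w → ∃ λ (k : Fin (length w)) → SquareAt w (toℕ k)
  ⇒squareAt w ([]     , b , x≢[] , _)    = contradiction refl x≢[]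
  ⇒squareAt w (c ∷ x′ , b , _    , refl) =
    fromℕ< k<  , subst (SquareAt w) (sym (toℕ-fromℕ< k<))
      (trans (cong (take (length x)) (drop-length x (x ++ b)))
      (trans (take-length x b) (sym (take-length x (x ++ b)))))
    where
    x = c ∷ x′
    k< : length x′ ℕ.< length w
    k< = ℕ.s≤s (subst (length x′ ℕ.≤_) (sym (List.length-++ x′)) (ℕ.m≤m+n _ _))

  startsWithSquare? : Decidable StartsWithSquare
  startsWithSquare? w =
    map′ (λ (k , s) → squareAt⇒ w k s) (⇒squareAt w)
      (Fin.any? λ k → ≡-dec Fin._≟_ (take (suc (toℕ k)) (drop (suc (toℕ k)) w)) (take (suc (toℕ k)) w))

containsSquare? : Decidable ContainsSquare
containsSquare? [] = no λ where
  ([]    , []    , b , x≢[] , _) → x≢[] refl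
  ([]    , _ ∷ _ , b , _    , ())
  (_ ∷ _ , _     , b , _    , ())
containsSquare? (c ∷ w) =
  map′ to from (startsWithSquare? (c ∷ w) ⊎-dec containsSquare? w)
  where
  to : StartsWithSquare (c ∷ w) ⊎ ContainsSquare w → ContainsSquare (c ∷ w)
  to (inj₁ (x , b , x≢[] , eq))     = [] , x , b , x≢[] , eq
  to (inj₂ (a , x , b , x≢[] , eq)) = c ∷ a , x , b , x≢[] , cong (c ∷_) eq

  from : ContainsSquare (c ∷ w) → StartsWithSquare (c ∷ w) ⊎ ContainsSquare w
  from ([]    , x , b , x≢[] , eq) = inj₁ (x , b , x≢[] , eq)
  from (d ∷ a , x , b , x≢[] , eq) = inj₂ (a , x , b , x≢[] , proj₂ (∷-injective eq))

squareFree? : Decidable SquareFree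
squareFree? w = ¬? (containsSquare? w)

-- Every word of the given length, each listed exactly once.
words : ℕ → List Word
words zero    = [] ∷ []
words (suc n) = cartesianProductWith _∷_ (allFin 3) (words n)

a : ℕ → ℕ
a n = length (filter squareFree? (words n))

_ : a 0 ∷ a 1 ∷ a 2 ∷ a 3 ∷ a 4 ∷ a 5 ∷ a 6 ∷ [] ≡ 1 ∷ 3 ∷ 6 ∷ 12 ∷ 18 ∷ 30 ∷ 42 ∷ []
_ = refl

------------------------------------------------------------------------
-- Dedekind reals

record ℝ : Set₁ where
  field
    L U         : ℚ → Set
    L-inhabited : ∃ L
    U-inhabited : ∃ U
    L-lower     : ∀ {q r} → q ℚ.< r → L r → L q
    U-upper     : ∀ {q r} → q ℚ.< r → U q → U r
    L-open      : ∀ {q} → L q → ∃[ r ] (q ℚ.< r × L r)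
    U-open      : ∀ {r} → U r → ∃[ q ] (q ℚ.< r × U q)
    disjoint    : ∀ {q} → ¬ (L q × U q)
    located     : ∀ {q r} → q ℚ.< r → L q ⊎ U r

open ℝ public

infix 4 _<ᴿ_ _≤ᴿ_

_<ᴿ_ : ℝ → ℝ → Set
x <ᴿ y = ∃[ q ] (U x q × L y q)

_≤ᴿ_ : ℝ → ℝ → Set
x ≤ᴿ y = ∀ {q} → L x q → L y q

fromℚ : ℚ → ℝ
fromℚ p = record
  { L           = ℚ._< p
  ; U           = p ℚ.<_
  ; L-inhabited = p ℚ.- 1ℚ , p-1<p
  ; U-inhabited = p ℚ.+ 1ℚ , p<p+1
  ; L-lower     = ℚ.<-trans
  ; U-upper     = λ q<r p<q → ℚ.<-trans p<q q<r
  ; L-open      = ℚ.<-dense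
  ; U-open      = λ p<r → let (m , p<m , m<r) = ℚ.<-dense p<r in m , m<r , p<m
  ; disjoint    = λ (q<p , p<q) → ℚ.<-asym q<p p<q
  ; located     = loc
  }
  where
  p-1<p : p ℚ.- 1ℚ ℚ.< p
  p-1<p = subst (p ℚ.- 1ℚ ℚ.<_) (ℚ.+-identityʳ p) (ℚ.+-monoʳ-< p (ℚ.negative⁻¹ (ℚ.- 1ℚ)))
  p<p+1 : p ℚ.< p ℚ.+ 1ℚ
  p<p+1 = subst (ℚ._< p ℚ.+ 1ℚ) (ℚ.+-identityʳ p) (ℚ.+-monoʳ-< p (ℚ.positive⁻¹ 1ℚ))
  loc : ∀ {q r} → q ℚ.< r → q ℚ.< p ⊎ p ℚ.< r
  loc {q} q<r with q ℚ.<? p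
  ... | yes q<p = inj₁ q<p
  ... | no  q≮p = inj₂ (ℚ.≤-<-trans (ℚ.≮⇒≥ q≮p) q<r)

ℕ→ℚ : ℕ → ℚ
ℕ→ℚ n = (ℤ.+ n) ℚ./ 1

fromℕ : ℕ → ℝ
fromℕ n = fromℚ (ℕ→ℚ n)

infixl 6 _+ᴿ_

_+ᴿ_ : ℝ → ℚ → ℝ
x +ᴿ ε = record
  { L           = λ q → L x (q ℚ.- ε)
  ; U           = λ q → U x (q ℚ.- ε)
  ; L-inhabited = let (q , h) = L-inhabited x in q ℚ.+ ε , subst (L x) (sym (cancel q)) h
  ; U-inhabited = let (q , h) = U-inhabited x in q ℚ.+ ε , subst (U x) (sym (cancel q)) h
  ; L-lower     = λ q<r → L-lower x (shift q<r)
  ; U-upper     = λ q<r → U-upper x (shift q<r)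
  ; L-open      = λ {q} h → let (r , q-ε<r , h′) = L-open x h in
                    r ℚ.+ ε ,
                    subst (ℚ._< r ℚ.+ ε) (cancel′ q) (ℚ.+-monoˡ-< ε q-ε<r) ,
                    subst (L x) (sym (cancel r)) h′
  ; U-open      = λ {r} h → let (q , q<r-ε , h′) = U-open x h in
                    q ℚ.+ ε ,
                    subst (q ℚ.+ ε ℚ.<_) (cancel′ r) (ℚ.+-monoˡ-< ε q<r-ε) ,
                    subst (U x) (sym (cancel q)) h′
  ; disjoint    = disjoint x
  ; located     = λ q<r → located x (shift q<r)
  }
  where
  cancel : ∀ q → (q ℚ.+ ε) ℚ.- ε ≡ q
  cancel q = trans (ℚ.+-assoc q ε (ℚ.- ε))
             (trans (cong (q ℚ.+_) (ℚ.+-inverseʳ ε)) (ℚ.+-identityʳ q))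
  cancel′ : ∀ q → (q ℚ.- ε) ℚ.+ ε ≡ q
  cancel′ q = trans (ℚ.+-assoc q (ℚ.- ε) ε)
              (trans (cong (q ℚ.+_) (ℚ.+-inverseˡ ε)) (ℚ.+-identityʳ q))
  shift : ∀ {q r} → q ℚ.< r → q ℚ.- ε ℚ.< r ℚ.- ε
  shift = ℚ.+-monoˡ-< (ℚ.- ε)

∣_-_∣<_ : ℝ → ℝ → ℚ → Set
∣ x - y ∣< ε = x <ᴿ y +ᴿ ε × y <ᴿ x +ᴿ ε

-- Sequences indexed by the positive integers.
Sequence⁺ : Set₁
Sequence⁺ = (n : ℕ) .{{_ : ℕ.NonZero n}} → ℝ

infix 4 _⟶_

_⟶_ : Sequence⁺ → ℝ → Set
s ⟶ μ = ∀ ε → 0ℚ ℚ.< ε →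
        ∃[ N ] (∀ n .{{_ : ℕ.NonZero n}} → N ℕ.≤ n → ∣ s n - μ ∣< ε)

------------------------------------------------------------------------
-- Roots

module ℚ-Powers where
  *-mono-<ˡ : ∀ {x y z} → 0ℚ ℚ.< z → x ℚ.< y → x ℚ.* z ℚ.< y ℚ.* z
  *-mono-<ˡ {z = z} 0<z = ℚ.*-monoˡ-<-pos z {{ℚ.positive 0<z}}

  *-mono-≤ : ∀ {x y u v} → 0ℚ ℚ.≤ u → 0ℚ ℚ.≤ y → x ℚ.≤ y → u ℚ.≤ v → x ℚ.* u ℚ.≤ y ℚ.* v
  *-mono-≤ {x} {y} {u} {v} 0≤u 0≤y x≤y u≤v =
    ℚ.≤-trans (ℚ.*-monoʳ-≤-nonNeg u {{ℚ.nonNegative 0≤u}} x≤y)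
              (ℚ.*-monoˡ-≤-nonNeg y {{ℚ.nonNegative 0≤y}} u≤v)

  *-nonNeg : ∀ {x y} → 0ℚ ℚ.≤ x → 0ℚ ℚ.≤ y → 0ℚ ℚ.≤ x ℚ.* y
  *-nonNeg {x} {y} 0≤x 0≤y =
    subst (ℚ._≤ x ℚ.* y) (ℚ.*-zeroˡ y) (ℚ.*-monoʳ-≤-nonNeg y {{ℚ.nonNegative 0≤y}} 0≤x)

  ^-nonNeg : ∀ k {x} → 0ℚ ℚ.≤ x → 0ℚ ℚ.≤ x ^ℚ k
  ^-nonNeg zero    _   = ℚ.nonNegative⁻¹ 1ℚ
  ^-nonNeg (suc k) 0≤x = *-nonNeg 0≤x (^-nonNeg k 0≤x)

  ^-pos : ∀ k {x} → 0ℚ ℚ.< x → 0ℚ ℚ.< x ^ℚ k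
  ^-pos zero    _   = ℚ.positive⁻¹ 1ℚ
  ^-pos (suc k) {x} 0<x =
    subst (ℚ._< x ^ℚ suc k) (ℚ.*-zeroˡ (x ^ℚ k)) (*-mono-<ˡ (^-pos k 0<x) 0<x)

  ^-mono-≤ : ∀ k {x y} → 0ℚ ℚ.≤ x → x ℚ.≤ y → x ^ℚ k ℚ.≤ y ^ℚ k
  ^-mono-≤ zero    _   _   = ℚ.≤-refl
  ^-mono-≤ (suc k) 0≤x x≤y =
    *-mono-≤ (^-nonNeg k 0≤x) (ℚ.≤-trans 0≤x x≤y) x≤y (^-mono-≤ k 0≤x x≤y)

  ^-mono-< : ∀ k .{{_ : ℕ.NonZero k}} {x y} → 0ℚ ℚ.≤ x → x ℚ.< y → x ^ℚ k ℚ.< y ^ℚ k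
  ^-mono-< (suc k) {x} {y} 0≤x x<y = ℚ.≤-<-trans
    (ℚ.*-monoˡ-≤-nonNeg x {{ℚ.nonNegative 0≤x}} (^-mono-≤ k 0≤x (ℚ.<⇒≤ x<y)))
    (*-mono-<ˡ (^-pos k (ℚ.≤-<-trans 0≤x x<y)) x<y)

  1≤^ : ∀ k {x} → 1ℚ ℚ.≤ x → 1ℚ ℚ.≤ x ^ℚ k
  1≤^ zero    _   = ℚ.≤-refl
  1≤^ (suc k) 1≤x = *-mono-≤ (ℚ.nonNegative⁻¹ 1ℚ) (ℚ.≤-trans (ℚ.nonNegative⁻¹ 1ℚ) 1≤x) 1≤x (1≤^ k 1≤x)

  x<x+1 : ∀ x → x ℚ.< x ℚ.+ 1ℚ
  x<x+1 x = subst (ℚ._< x ℚ.+ 1ℚ) (ℚ.+-identityʳ x) (ℚ.+-monoʳ-< x (ℚ.positive⁻¹ 1ℚ))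

  -- For y > 0, division by y.
  quotient : ∀ s {y} → 0ℚ ℚ.< y → ∃[ z ] z ℚ.* y ≡ s
  quotient s {y} 0<y = s ℚ.* (ℚ.1/ y) , trans (ℚ.*-assoc s (ℚ.1/ y) y)
    (trans (cong (s ℚ.*_) (ℚ.*-inverseˡ y)) (ℚ.*-identityʳ s))
    where instance _ = ℚ.pos⇒nonZero y {{ℚ.positive 0<y}}

  cancel-< : ∀ {x z y} → 0ℚ ℚ.< y → x ℚ.* y ℚ.< z ℚ.* y → x ℚ.< z
  cancel-< {y = y} 0<y = ℚ.*-cancelʳ-<-nonNeg y {{ℚ.nonNegative (ℚ.<⇒≤ 0<y)}}

  increase : ∀ {x y s} → 0ℚ ℚ.≤ y → x ℚ.* y ℚ.< s → ∃[ x′ ] (x ℚ.< x′ × x′ ℚ.* y ℚ.< s)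
  increase {x} {y} {s} 0≤y xy<s with ℚ.<-cmp 0ℚ y
  ... | tri> _ _ y<0 = contradiction (ℚ.<-≤-trans y<0 0≤y) (ℚ.<-irrefl refl)
  ... | tri≈ _ refl _ = x ℚ.+ 1ℚ , x<x+1 x ,
          subst (ℚ._< s) (trans (ℚ.*-zeroʳ x) (sym (ℚ.*-zeroʳ (x ℚ.+ 1ℚ)))) xy<s
  ... | tri< 0<y _ _ with quotient s 0<y
  ...   | z , refl with ℚ.<-dense (cancel-< {x} {z} 0<y xy<s)
  ...     | x′ , x<x′ , x′<z = x′ , x<x′ , *-mono-<ˡ 0<y x′<z

  decrease : ∀ {x y s} → 0ℚ ℚ.< x → 0ℚ ℚ.< y → s ℚ.< x ℚ.* y →
             ∃[ x′ ] (0ℚ ℚ.< x′ × x′ ℚ.< x × s ℚ.< x′ ℚ.* y)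
  decrease {x} {y} {s} 0<x 0<y s<xy with quotient s 0<y
  ... | z , refl with ℚ.<-dense (cancel-< {z} {x} 0<y s<xy) | ℚ.<-dense 0<x
  ...   | u , z<u , u<x | v , 0<v , v<x with ℚ.≤-total u v
  ...     | inj₁ u≤v = v , 0<v , v<x , *-mono-<ˡ 0<y (ℚ.<-≤-trans z<u u≤v)
  ...     | inj₂ v≤u = u , ℚ.<-≤-trans 0<v v≤u , u<x , *-mono-<ˡ 0<y z<u

  ^-increase : ∀ k {x s} → 0ℚ ℚ.≤ x → x ^ℚ k ℚ.< s → ∃[ x′ ] (x ℚ.< x′ × x′ ^ℚ k ℚ.< s)
  ^-increase zero    {x} _ 1<s = x ℚ.+ 1ℚ , x<x+1 x , 1<s
  ^-increase (suc k) {x} {s} 0≤x h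
    with increase (^-nonNeg k 0≤x) h
  ... | u , x<u , h₁
    with increase (ℚ.≤-trans 0≤x (ℚ.<⇒≤ x<u)) (subst (ℚ._< s) (ℚ.*-comm u (x ^ℚ k)) h₁)
  ... | t , xᵏ<t , h₂ with ^-increase k 0≤x xᵏ<t
  ... | v , x<v , vᵏ<t with ℚ.≤-total u v
  ... | inj₁ u≤v = u , x<u , ℚ.≤-<-trans
          (*-mono-≤ (^-nonNeg k 0≤u) 0≤u ℚ.≤-refl
            (ℚ.≤-trans (^-mono-≤ k 0≤u u≤v) (ℚ.<⇒≤ vᵏ<t)))
          (subst (ℚ._< s) (ℚ.*-comm t u) h₂)
    where 0≤u = ℚ.≤-trans 0≤x (ℚ.<⇒≤ x<u)
  ... | inj₂ v≤u = v , x<v , ℚ.≤-<-trans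
          (*-mono-≤ (^-nonNeg k 0≤v) (ℚ.≤-trans 0≤v v≤u) v≤u (ℚ.<⇒≤ vᵏ<t))
          (subst (ℚ._< s) (ℚ.*-comm t u) h₂)
    where 0≤v = ℚ.≤-trans 0≤x (ℚ.<⇒≤ x<v)

  ^-decrease : ∀ k {x s} → 0ℚ ℚ.< x → s ℚ.< x ^ℚ k →
               ∃[ x′ ] (0ℚ ℚ.< x′ × x′ ℚ.< x × s ℚ.< x′ ^ℚ k)
  ^-decrease zero 0<x s<1 with ℚ.<-dense 0<x
  ... | v , 0<v , v<x = v , 0<v , v<x , s<1
  ^-decrease (suc k) {x} {s} 0<x h with decrease 0<x (^-pos k 0<x) h
  ... | u , 0<u , u<x , h₁
    with decrease (^-pos k 0<x) 0<u (subst (s ℚ.<_) (ℚ.*-comm u (x ^ℚ k)) h₁)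
  ... | t , 0<t , t<xᵏ , h₂ with ^-decrease k 0<x t<xᵏ
  ... | v , 0<v , v<x , t<vᵏ with ℚ.≤-total u v
  ... | inj₁ u≤v = v , 0<v , v<x , ℚ.<-≤-trans (subst (s ℚ.<_) (ℚ.*-comm t u) h₂)
          (*-mono-≤ (ℚ.<⇒≤ 0<t) (ℚ.<⇒≤ 0<v) u≤v (ℚ.<⇒≤ t<vᵏ))
  ... | inj₂ v≤u = u , 0<u , u<x , ℚ.<-≤-trans (subst (s ℚ.<_) (ℚ.*-comm t u) h₂)
          (*-mono-≤ (ℚ.<⇒≤ 0<t) (ℚ.<⇒≤ 0<u) ℚ.≤-refl
            (ℚ.≤-trans (ℚ.<⇒≤ t<vᵏ) (^-mono-≤ k (ℚ.<⇒≤ 0<v) v≤u)))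

  0≤ℕ→ℚ : ∀ b → 0ℚ ℚ.≤ ℕ→ℚ b
  0≤ℕ→ℚ b = ℚ.nonNegative⁻¹ (ℕ→ℚ b) {{ℚ.normalize-nonNeg b 1}}

open ℚ-Powers

-- The non-negative k-th root of b, as a cut: for q ≥ 0, q lies below the root
-- iff qᵏ < b; for q > 0, q lies above the root iff b < qᵏ.
root : (k : ℕ) .{{_ : ℕ.NonZero k}} → ℕ → ℝ
root k b = record
  { L           = Lo
  ; U           = Up
  ; L-inhabited = ℚ.- 1ℚ , inj₁ (ℚ.negative⁻¹ (ℚ.- 1ℚ))
  ; U-inhabited = B ℚ.+ 1ℚ , up-inhabited k
  ; L-lower     = lower
  ; U-upper     = upper
  ; L-open      = lo-open
  ; U-open      = up-open
  ; disjoint    = disj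
  ; located     = loc
  }
  where
  B = ℕ→ℚ b

  Lo Up : ℚ → Set
  Lo q = q ℚ.< 0ℚ ⊎ q ^ℚ k ℚ.< B
  Up q = 0ℚ ℚ.< q × B ℚ.< q ^ℚ k

  up-inhabited : ∀ j .{{_ : ℕ.NonZero j}} → 0ℚ ℚ.< B ℚ.+ 1ℚ × B ℚ.< (B ℚ.+ 1ℚ) ^ℚ j
  up-inhabited (suc j) = 0<B+1 , ℚ.<-≤-trans (x<x+1 B)
    (subst (ℚ._≤ (B ℚ.+ 1ℚ) ^ℚ suc j) (ℚ.*-identityʳ (B ℚ.+ 1ℚ))
      (*-mono-≤ (ℚ.nonNegative⁻¹ 1ℚ) (ℚ.<⇒≤ 0<B+1) ℚ.≤-refl (1≤^ j 1≤B+1)))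
    where
    0<B+1 = ℚ.≤-<-trans (0≤ℕ→ℚ b) (x<x+1 B)
    1≤B+1 = subst (ℚ._≤ B ℚ.+ 1ℚ) (ℚ.+-identityˡ 1ℚ) (ℚ.+-monoˡ-≤ 1ℚ (0≤ℕ→ℚ b))

  lower : ∀ {q r} → q ℚ.< r → Lo r → Lo q
  lower q<r (inj₁ r<0) = inj₁ (ℚ.<-trans q<r r<0)
  lower {q} q<r (inj₂ rᵏ<B) with q ℚ.<? 0ℚ
  ... | yes q<0 = inj₁ q<0
  ... | no  q≮0 = inj₂ (ℚ.≤-<-trans (^-mono-≤ k (ℚ.≮⇒≥ q≮0) (ℚ.<⇒≤ q<r)) rᵏ<B)

  upper : ∀ {q r} → q ℚ.< r → Up q → Up r
  upper q<r (0<q , B<qᵏ) =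
    ℚ.<-trans 0<q q<r , ℚ.<-≤-trans B<qᵏ (^-mono-≤ k (ℚ.<⇒≤ 0<q) (ℚ.<⇒≤ q<r))

  lo-open : ∀ {q} → Lo q → ∃[ r ] (q ℚ.< r × Lo r)
  lo-open {q} h with q ℚ.<? 0ℚ
  lo-open h           | yes q<0 = let (m , q<m , m<0) = ℚ.<-dense q<0 in m , q<m , inj₁ m<0
  lo-open (inj₁ q<0)  | no  q≮0 = contradiction q<0 q≮0
  lo-open (inj₂ qᵏ<B) | no  q≮0 =
    let (r , q<r , rᵏ<B) = ^-increase k (ℚ.≮⇒≥ q≮0) qᵏ<B in r , q<r , inj₂ rᵏ<B

  up-open : ∀ {r} → Up r → ∃[ q ] (q ℚ.< r × Up q)
  up-open (0<r , B<rᵏ) =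
    let (q , 0<q , q<r , B<qᵏ) = ^-decrease k 0<r B<rᵏ in q , q<r , 0<q , B<qᵏ

  disj : ∀ {q} → ¬ (Lo q × Up q)
  disj (inj₁ q<0  , 0<q , _)    = ℚ.<-asym q<0 0<q
  disj (inj₂ qᵏ<B , _   , B<qᵏ) = ℚ.<-asym qᵏ<B B<qᵏ

  loc : ∀ {q r} → q ℚ.< r → Lo q ⊎ Up r
  loc {q} q<r with q ℚ.<? 0ℚ | q ^ℚ k ℚ.<? B
  ... | yes q<0 | _        = inj₁ (inj₁ q<0)
  ... | no  _   | yes qᵏ<B = inj₁ (inj₂ qᵏ<B)
  ... | no  q≮0 | no  qᵏ≮B = inj₂
    (ℚ.≤-<-trans 0≤q q<r , ℚ.≤-<-trans (ℚ.≮⇒≥ qᵏ≮B) (^-mono-< k 0≤q q<r))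
    where 0≤q = ℚ.≮⇒≥ q≮0

-- b ^[ m / k ] is the real number b^(m/k).
_^[_/_] : ℕ → (m k : ℕ) .{{_ : ℕ.NonZero k}} → ℝ
b ^[ m / k ] = root k (b ℕ.^ m)

-- n ↦ a(n)^(1/n)
growth : Sequence⁺
growth n = a n ^[ 1 / n ]

{-# OPTIONS --safe #-}
-- Brinkhuis's construction: each letter l is replaced by one of two words of
-- length 18, and every choice of replacements turns a square-free word of
-- length n into a different square-free word of length 18n. Hence
-- a(18n) ≥ 2ⁿ a(n), while submultiplicativity gives a(18n) ≤ a(n)¹⁸; as
-- a(n) > 0, this is already a(n)¹⁷ ≥ 2ⁿ. An image has no square of period ≤ 18,
-- because such a square lies within three blocks. A longer square contains a
-- window that determines its position modulo 18, so its period is a multiple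
-- of 18 and it comes from a square in the original word. The limit of a(n)^(1/n) is
-- its infimum by Fekete's argument.
module Submission where

open import Defs
open import Axiom.ExcludedMiddle using (ExcludedMiddle)
open import Data.Nat.Base using (ℕ)
open import Data.Product using (∃; _×_)
open import Level using (0ℓ)

module Words where

  open import Data.Nat.Base using (zero; suc; _+_; _*_; _∸_; _⊓_; _^_; _≤_; _<_; z≤n; s≤s; s≤s⁻¹; >-nonZero)
  import Data.Nat.Properties as ℕ
  open import Algebra.Properties.CommutativeSemigroup ℕ.+-commutativeSemigroup using (xy∙z≈xz∙y)
  open import Data.Nat.DivMod using (_divMod_; result)
  open import Data.Nat.Tactic.RingSolver using (solve-∀)
  open import Data.Fin.Base using (Fin; toℕ; fromℕ<)
  open import Data.Fin.Patterns using (0F; 1F; 2F)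
  import Data.Fin.Properties as Fin
  open import Data.List.Base
    using (List; []; _∷_; _++_; length; map; concatMap; take; drop; filter; zip; allFin;
           cartesianProduct; cartesianProductWith)
  open import Data.List.Properties as List using (≡-dec)
  open import Data.List.Membership.Propositional using (_∈_)
  open import Data.List.Membership.Propositional.Properties
  open import Data.List.Relation.Unary.Any using (here; there)
  import Data.List.Relation.Unary.All as All
  open import Data.List.Relation.Unary.AllPairs using ([]; _∷_)
  open import Data.List.Relation.Unary.Unique.Propositional using (Unique)
  import Data.List.Relation.Unary.Unique.Propositional.Properties as Unique
  open import Data.Product using (∃₂; _,_; proj₁; proj₂)
  open import Data.Product.Properties as × using (,-injective)
  open import Data.Sum.Base using (inj₁; inj₂)
  open import Relation.Binary.PropositionalEquality
    using (_≡_; _≢_; refl; sym; trans; cong; cong₂; subst; subst₂; ≢-sym; module ≡-Reasoning)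
  open import Relation.Nullary using (¬_; Dec; yes; no; contradiction)
  open import Relation.Nullary.Decidable using (from-yes; map′; ¬?; _→-dec_)

  -- Blocks and the finite checks on them.

  Symbol : Set
  Symbol = Letter × Fin 2

  letter : Symbol → Letter
  letter = proj₁

  rotate : Letter → Letter
  rotate 0F = 1F
  rotate 1F = 2F
  rotate 2F = 0F

  -- Addition modulo 3, so the blocks of every letter are translates of the two base words.
  _⊕_ : Letter → Letter → Letter
  0F ⊕ y = y
  1F ⊕ y = rotate y
  2F ⊕ y = rotate (rotate y)

  -- Found by computer search. As both words end with 0, block (l , c) ends with l.
  base : Fin 2 → Word
  base 0F = 0F ∷ 1F ∷ 2F ∷ 0F ∷ 2F ∷ 1F ∷ 0F ∷ 2F ∷ 0F ∷ 1F ∷ 0F ∷ 2F ∷ 1F ∷ 2F ∷ 0F ∷ 2F ∷ 1F ∷ 0F ∷ []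
  base 1F = 0F ∷ 1F ∷ 2F ∷ 0F ∷ 2F ∷ 1F ∷ 2F ∷ 0F ∷ 1F ∷ 0F ∷ 2F ∷ 0F ∷ 1F ∷ 2F ∷ 0F ∷ 2F ∷ 1F ∷ 0F ∷ []

  block : Symbol → Word
  block (l , c) = map (l ⊕_) (base c)

  factor : {A : Set} → ℕ → ℕ → List A → List A
  factor i ℓ w = take ℓ (drop i w)

  allSymbols? : {P : Symbol → Set} → (∀ e → Dec (P e)) → Dec (∀ e → P e)
  allSymbols? P? = map′ (λ f e → f (proj₁ e) (proj₂ e)) (λ f l c → f (l , c))
    (Fin.all? λ l → Fin.all? λ c → P? (l , c))

  _≢letter?_ : (e f : Symbol) → Dec (letter e ≢ letter f)
  e ≢letter? f = ¬? (letter e Fin.≟ letter f)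

  -- With `toℕ r ≤ 17` and `p ≤ 18` a square ends by position 53, inside the 54 letters of a triple
  -- of blocks, so `factor` never truncates there.
  NoShortSquare : Word → Set
  NoShortSquare w = ∀ (r q : Fin 18) → let p = suc (toℕ q) in
                    factor (toℕ r) p w ≢ factor (toℕ r + p) p w

  noShortSquare? : ∀ w → Dec (NoShortSquare w)
  noShortSquare? w = Fin.all? λ r → Fin.all? λ q → let p = suc (toℕ q) in
    ¬? (≡-dec Fin._≟_ (factor (toℕ r) p w) (factor (toℕ r + p) p w))

  NoShortSquareInTriples : Set
  NoShortSquareInTriples = ∀ e f g → letter e ≢ letter f → letter f ≢ letter g →
                           NoShortSquare (block e ++ block f ++ block g)

  noShortSquareInTriples? : Dec NoShortSquareInTriples
  noShortSquareInTriples? = allSymbols? λ e → allSymbols? λ f → allSymbols? λ g →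
    (e ≢letter? f) →-dec (f ≢letter? g) →-dec noShortSquare? (block e ++ block f ++ block g)

  abstract
    noShortSquareInTriples : NoShortSquareInTriples
    noShortSquareInTriples = from-yes noShortSquareInTriples?

  _⊖_ : Letter → Letter → Letter
  x ⊖ 0F = x
  x ⊖ 1F = rotate (rotate x)
  x ⊖ 2F = rotate x

  -- Differences modulo 3 cancel the translation by `l`, so inside a block they depend only on the
  -- choice `c`. A position can then be recognised without knowing the letter.
  steps : Word → Word
  steps (x ∷ w@(y ∷ _)) = (y ⊖ x) ∷ steps w
  steps _ = []

  -- Each of the four patterns occurs at a single position modulo 18 in the step
  -- sequence of an image, and every 19-letter window contains one of them, so
  -- offset is the position of a window modulo 18.
  offset : Word → ℕ
  offset (1F ∷ 2F ∷ 2F ∷ 1F ∷ 1F ∷ 1F ∷ 2F ∷ _) = 2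
  offset (2F ∷ 2F ∷ 2F ∷ 2F ∷ 1F ∷ 1F ∷ 2F ∷ _) = 3
  offset (1F ∷ 2F ∷ 2F ∷ 2F ∷ 1F ∷ 1F ∷ 1F ∷ _) = 13
  offset (2F ∷ 2F ∷ 2F ∷ 2F ∷ 1F ∷ 1F ∷ 1F ∷ _) = 14
  offset (_ ∷ w) with offset w
  ... | zero  = 17
  ... | suc n = n
  offset [] = 0

  -- Nineteen letters starting at `toℕ r ≤ 17` end by position 36, so two blocks contain every such
  -- window. The check on triples leaves only periods of at least 19, and each half of such a square
  -- contains a window.
  Synchronising : Set
  Synchronising = ∀ e f → letter e ≢ letter f → ∀ (r : Fin 18) →
                  offset (steps (factor (toℕ r) 19 (block e ++ block f))) ≡ toℕ r

  synchronising? : Dec Synchronising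
  synchronising? = allSymbols? λ e → allSymbols? λ f → (e ≢letter? f) →-dec
    Fin.all? λ r → offset (steps (factor (toℕ r) 19 (block e ++ block f))) ℕ.≟ toℕ r

  abstract
    synchronising : Synchronising
    synchronising = from-yes synchronising?

  -- Factors of lists, and squares given by position and period.

  take-drop-take : ∀ {A : Set} o {ℓ p} (w : List A) → o + ℓ ≤ p → take ℓ (drop o (take p w)) ≡ take ℓ (drop o w)
  take-drop-take zero    {ℓ} {p} w ℓ≤p = trans (List.take-take ℓ p w) (cong (λ n → take n w) (ℕ.m≤n⇒m⊓n≡m ℓ≤p))
  take-drop-take (suc o) []      (s≤s _)   = refl
  take-drop-take (suc o) (x ∷ w) (s≤s le)  = take-drop-take o w le

  factor-factor : ∀ {A : Set} {o ℓ p} i (w : List A) → o + ℓ ≤ p → factor o ℓ (factor i p w) ≡ factor (i + o) ℓ w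
  factor-factor {o = o} {ℓ} i w le =
    trans (take-drop-take o (drop i w) le) (cong (take ℓ) (List.drop-drop i o w))

  factor-cong : ∀ {A : Set} {o ℓ p} i j {v w : List A} → factor i p v ≡ factor j p w → o + ℓ ≤ p →
                factor (i + o) ℓ v ≡ factor (j + o) ℓ w
  factor-cong {o = o} {ℓ} i j {v} {w} eq le =
    trans (sym (factor-factor i v le)) (trans (cong (factor o ℓ) eq) (factor-factor j w le))

  factor-++ˡ : ∀ {A : Set} i ℓ (v : List A) {w} → i + ℓ ≤ length v → factor i ℓ (v ++ w) ≡ factor i ℓ v
  factor-++ˡ zero    zero    v       _        = refl
  factor-++ˡ zero    (suc ℓ) (x ∷ v) (s≤s le) = cong (x ∷_) (factor-++ˡ zero ℓ v le)
  factor-++ˡ (suc i) ℓ       (x ∷ v) (s≤s le) = factor-++ˡ i ℓ v le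

  factor-++ʳ : ∀ {A : Set} (v x : List A) {w} → factor (length v) (length x) (v ++ x ++ w) ≡ x
  factor-++ʳ []      []      = refl
  factor-++ʳ []      (c ∷ x) = cong (c ∷_) (factor-++ʳ [] x)
  factor-++ʳ (_ ∷ v) x       = factor-++ʳ v x

  factor-suc : ∀ {A : Set} i m (w : List A) → factor i (suc m) w ≡ factor i 1 w ++ factor (suc i) m w
  factor-suc zero    m []      = sym (List.take-[] m)
  factor-suc zero    m (x ∷ w) = refl
  factor-suc (suc i) m []      = sym (List.take-[] m)
  factor-suc (suc i) m (x ∷ w) = factor-suc i m w

  -- Single letters are compared as factors of length 1, which are empty past the end of a list;
  -- this avoids bounds and default letters.
  factor-ext : ∀ {A : Set} m i j {v w : List A} → (∀ k → k < m → factor (i + k) 1 v ≡ factor (j + k) 1 w) →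
               factor i m v ≡ factor j m w
  factor-ext zero    i j _ = refl
  factor-ext (suc m) i j {v} {w} h = begin
    factor i (suc m) v                  ≡⟨ factor-suc i m v ⟩
    factor i 1 v ++ factor (suc i) m v  ≡⟨ cong₂ _++_ head tail ⟩
    factor j 1 w ++ factor (suc j) m w  ≡⟨ factor-suc j m w ⟨
    factor j (suc m) w                  ∎
    where
    open ≡-Reasoning
    head = subst₂ (λ i j → factor i 1 v ≡ factor j 1 w) (ℕ.+-identityʳ i) (ℕ.+-identityʳ j) (h 0 (s≤s z≤n))
    tail = factor-ext m (suc i) (suc j) {v} {w} λ k k<m →
      subst₂ (λ i j → factor i 1 v ≡ factor j 1 w) (ℕ.+-suc i k) (ℕ.+-suc j k) (h (suc k) (s≤s k<m))

  -- The length bound excludes false squares: past the end of `w` both factors are truncated and may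
  -- agree for that reason alone.
  SquareAt : Word → ℕ → ℕ → Set
  SquareAt w i p = 0 < p × i + (p + p) ≤ length w × factor i p w ≡ factor (i + p) p w

  containsSquare⇒squareAt : ∀ {w} → ContainsSquare w → ∃₂ (SquareAt w)
  containsSquare⇒squareAt (u , []    , b , x≢[] , eq)   = contradiction refl x≢[]
  containsSquare⇒squareAt (u , x@(_ ∷ _) , b , _ , refl) =
    length u , length x , s≤s z≤n , bound ,
    trans (factor-++ʳ u x) (sym (trans (cong₂ (λ i w → factor i (length x) w)
      (sym (List.length-++ u)) (sym (List.++-assoc u x (x ++ b)))) (factor-++ʳ (u ++ x) x)))
    where
    bound : length u + (length x + length x) ≤ length (u ++ x ++ x ++ b)
    bound = begin
      length u + (length x + length x)      ≡⟨ cong (length u +_) (List.length-++ x) ⟨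
      length u + length (x ++ x)            ≤⟨ ℕ.+-monoʳ-≤ (length u) (List.length-++-≤ˡ (x ++ x)) ⟩
      length u + length ((x ++ x) ++ b)     ≡⟨ cong (λ z → length u + length z) (List.++-assoc x x b) ⟩
      length u + length (x ++ x ++ b)       ≡⟨ List.length-++ u ⟨
      length (u ++ x ++ x ++ b)             ∎
      where open ℕ.≤-Reasoning

  squareAt⇒containsSquare : ∀ w i p → SquareAt w i p → ContainsSquare w
  squareAt⇒containsSquare w i p (0<p , le , eq) =
    take i w , factor i p w , drop p (drop p (drop i w)) , nonempty , split
    where
    open ≡-Reasoning
    p≤ : p ≤ length (drop i w)
    p≤ = subst (p ≤_) (sym (List.length-drop i w))
           (ℕ.m+n≤o⇒m≤o∸n p (ℕ.≤-trans (ℕ.≤-trans (ℕ.≤-reflexive (ℕ.+-comm p i)) (ℕ.+-monoʳ-≤ i (ℕ.m≤m+n p p))) le))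
    nonempty : factor i p w ≢ []
    nonempty e = ℕ.<⇒≢ 0<p (sym (begin
      p                            ≡⟨ ℕ.m≤n⇒m⊓n≡m p≤ ⟨
      p ⊓ length (drop i w)        ≡⟨ List.length-take p (drop i w) ⟨
      length (factor i p w)        ≡⟨ cong length e ⟩
      0                            ∎))
    split : w ≡ take i w ++ factor i p w ++ factor i p w ++ drop p (drop p (drop i w))
    split = begin
      w                                 ≡⟨ List.take++drop≡id i w ⟨
      take i w ++ drop i w              ≡⟨ cong (take i w ++_) (List.take++drop≡id p (drop i w)) ⟨
      take i w ++ factor i p w ++ drop p (drop i w)
        ≡⟨ cong (λ z → take i w ++ factor i p w ++ z) (List.take++drop≡id p (drop p (drop i w))) ⟨
      take i w ++ factor i p w ++ take p (drop p (drop i w)) ++ drop p (drop p (drop i w))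
        ≡⟨ cong (λ z → take i w ++ factor i p w ++ z ++ drop p (drop p (drop i w)))
             (trans (cong (take p) (List.drop-drop i p w)) (sym eq)) ⟩
      take i w ++ factor i p w ++ factor i p w ++ drop p (drop p (drop i w)) ∎

  squareFree-++⁻ : ∀ u v {y} → SquareFree (u ++ v ++ y) → SquareFree v
  squareFree-++⁻ u v {y} sf (c , x , b , x≢[] , refl) = sf (u ++ c , x , b ++ y , x≢[] , (begin
    u ++ (c ++ x ++ x ++ b) ++ y ≡⟨ cong (u ++_) (List.++-assoc c (x ++ x ++ b) y) ⟩
    u ++ c ++ (x ++ x ++ b) ++ y ≡⟨ cong (λ z → u ++ c ++ z) (trans (List.++-assoc x (x ++ b) y) (cong (x ++_) (List.++-assoc x b y))) ⟩
    u ++ c ++ x ++ x ++ b ++ y   ≡⟨ List.++-assoc u c _ ⟨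
    (u ++ c) ++ x ++ x ++ b ++ y ∎))
    where open ≡-Reasoning

  squareFree-drop : ∀ i {w} → SquareFree w → SquareFree (drop i w)
  squareFree-drop i {w} sf = squareFree-++⁻ (take i w) (drop i w) {[]}
    (subst SquareFree (trans (sym (List.take++drop≡id i w)) (cong (take i w ++_) (sym (List.++-identityʳ (drop i w))))) sf)

  -- Images of square-free words are square-free.

  image : List Symbol → Word
  image = concatMap block

  length-image : ∀ d → length (image d) ≡ length d * 18
  length-image []             = refl
  length-image ((l , 0F) ∷ d) = cong (18 +_) (length-image d)
  length-image ((l , 1F) ∷ d) = cong (18 +_) (length-image d)

  length-block : ∀ e → length (block e) ≡ 18
  length-block (_ , 0F) = refl
  length-block (_ , 1F) = refl

  length-blocks : ∀ e f → length (block e ++ block f) ≡ 36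
  length-blocks e f = trans (List.length-++ (block e)) (cong₂ _+_ (length-block e) (length-block f))

  drop-image : ∀ s d → drop (s * 18) (image d) ≡ image (drop s d)
  drop-image zero    d              = refl
  drop-image (suc s) []             = refl
  drop-image (suc s) ((l , 0F) ∷ d) = drop-image s d
  drop-image (suc s) ((l , 1F) ∷ d) = drop-image s d

  -- All blocks have length 18, so the first `s` of them can be discarded. Claims about a factor at
  -- any position thus reduce to a start inside the first block.
  factor-image : ∀ r s ℓ d → factor (r + s * 18) ℓ (image d) ≡ factor r ℓ (image (drop s d))
  factor-image r s ℓ d = cong (take ℓ) (begin
    drop (r + s * 18) (image d)      ≡⟨ cong (λ n → drop n (image d)) (ℕ.+-comm r (s * 18)) ⟩
    drop (s * 18 + r) (image d)      ≡⟨ List.drop-drop (s * 18) r (image d) ⟨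
    drop r (drop (s * 18) (image d)) ≡⟨ cong (drop r) (drop-image s d) ⟩
    drop r (image (drop s d))        ∎)
    where open ≡-Reasoning

  ⊕-0 : ∀ l → l ⊕ 0F ≡ l
  ⊕-0 0F = refl
  ⊕-0 1F = refl
  ⊕-0 2F = refl

  last-image : ∀ d → factor 17 1 (image d) ≡ factor 0 1 (map letter d)
  last-image []             = refl
  last-image ((l , 0F) ∷ d) = cong (_∷ []) (⊕-0 l)
  last-image ((l , 1F) ∷ d) = cong (_∷ []) (⊕-0 l)

  sample : ∀ s d → factor (17 + s * 18) 1 (image d) ≡ factor s 1 (map letter d)
  sample s d = trans (factor-image 17 s 1 d)
    (trans (last-image (drop s d)) (cong (take 1) (sym (List.drop-map s d))))

  head-≢ : ∀ {x y : Letter} {w} → SquareFree (x ∷ y ∷ w) → x ≢ y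
  head-≢ {x} sf refl = sf ([] , x ∷ [] , _ , (λ ()) , refl)

  rotate-≢ : ∀ x → x ≢ rotate x
  rotate-≢ 0F ()
  rotate-≢ 1F ()
  rotate-≢ 2F ()

  ≤-length-image : ∀ d {n} → n ≤ length (image d) → n ≤ length d * 18
  ≤-length-image d = subst (_ ≤_) (length-image d)

  -- In contrast to `NoShortSquare`, the square must fit into `w`: an image of fewer than three
  -- blocks would truncate the factors.
  NoShortSquareIn : Word → Set
  NoShortSquareIn w = ∀ (r q : Fin 18) → let p = suc (toℕ q) in toℕ r + (p + p) ≤ length w →
                      factor (toℕ r) p w ≢ factor (toℕ r + p) p w

  noShortSquareIn-++⁻ : ∀ v {w} → NoShortSquareIn (v ++ w) → NoShortSquareIn v
  noShortSquareIn-++⁻ v {w} h r q le eq = h r q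
    (ℕ.≤-trans le (List.length-++-≤ˡ v))
    (trans (factor-++ˡ (toℕ r) p v (ℕ.≤-trans (ℕ.+-monoʳ-≤ (toℕ r) (ℕ.m≤m+n p p)) le))
      (trans eq (sym (factor-++ˡ (toℕ r + p) p v (subst (_≤ length v) (sym (ℕ.+-assoc (toℕ r) p p)) le)))))
    where p = suc (toℕ q)

  -- A square starting before position 18 with period at most 18 ends within the first 54 letters,
  -- hence inside `v`.
  noShortSquareIn-++⁺ : ∀ v {w} → 54 ≤ length v → NoShortSquareIn v → NoShortSquareIn (v ++ w)
  noShortSquareIn-++⁺ v {w} 54≤ h r q _ eq = h r q le
    (trans (sym (factor-++ˡ (toℕ r) p v (ℕ.≤-trans (ℕ.+-monoʳ-≤ (toℕ r) (ℕ.m≤m+n p p)) le)))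
      (trans eq (factor-++ˡ (toℕ r + p) p v (subst (_≤ length v) (sym (ℕ.+-assoc (toℕ r) p p)) le))))
    where
    p = suc (toℕ q)
    le : toℕ r + (p + p) ≤ length v
    le = ℕ.≤-trans (ℕ.+-mono-≤ (ℕ.<⇒≤ (Fin.toℕ<n r)) (ℕ.+-mono-≤ (Fin.toℕ<n q) (Fin.toℕ<n q))) 54≤

  noShortSquare-image : ∀ d → SquareFree (map letter d) → NoShortSquareIn (image d)
  noShortSquare-image []          _  r q le = contradiction (ℕ.≤-trans (ℕ.m≤n+m _ (toℕ r)) le) λ ()
  -- Images of one or two blocks are prolonged to a triple with adjacent letters distinct; the
  -- result for the triple then passes to its prefix.
  noShortSquare-image (e ∷ [])    sf = noShortSquareIn-++⁻ (block e ++ [])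
    (subst NoShortSquareIn (cong (_++ block f ++ block e) (sym (List.++-identityʳ (block e))))
      λ r q _ → noShortSquareInTriples e f e (rotate-≢ (letter e)) (≢-sym (rotate-≢ (letter e))) r q)
    where f = rotate (letter e) , 0F
  noShortSquare-image (e ∷ f ∷ []) sf = noShortSquareIn-++⁻ (block e ++ block f ++ [])
    (subst NoShortSquareIn (trans (sym (List.++-assoc (block e) _ _)) (cong (λ z → (block e ++ z) ++ block e) (sym (List.++-identityʳ (block f)))))
      λ r q _ → noShortSquareInTriples e f e (head-≢ sf) (≢-sym (head-≢ sf)) r q)
  noShortSquare-image (e ∷ f ∷ g ∷ d) sf =
    subst NoShortSquareIn (trans (List.++-assoc (block e) _ _) (cong (block e ++_) (List.++-assoc (block f) (block g) (image d))))
      (noShortSquareIn-++⁺ (block e ++ block f ++ block g)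
        (ℕ.≤-reflexive (sym (trans (List.length-++ (block e)) (cong₂ _+_ (length-block e) (length-blocks f g)))))
        λ r q _ → noShortSquareInTriples e f g (head-≢ sf) (head-≢ (squareFree-drop 1 sf)) r q)

  offset-image : ∀ d → SquareFree (map letter d) → ∀ (r : Fin 18) → toℕ r + 19 ≤ length (image d) →
                 offset (steps (factor (toℕ r) 19 (image d))) ≡ toℕ r
  offset-image []       _ r le = contradiction (ℕ.≤-trans (ℕ.m≤n+m 19 (toℕ r)) le) λ ()
  offset-image (e ∷ []) _ r le = contradiction (ℕ.≤-trans (ℕ.m≤n+m 19 (toℕ r)) (≤-length-image (e ∷ []) le)) (ℕ.<-irrefl refl)
  offset-image (e ∷ f ∷ d) sf r le = trans
    (cong (λ z → offset (steps z)) (trans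
      (cong (factor (toℕ r) 19) (sym (List.++-assoc (block e) (block f) (image d))))
      (factor-++ˡ (toℕ r) 19 (block e ++ block f)
        (ℕ.≤-trans (ℕ.+-monoˡ-≤ 19 (s≤s⁻¹ (Fin.toℕ<n r)))
          (ℕ.≤-reflexive (sym (length-blocks e f)))))))
    (synchronising e f (head-≢ sf) r)

  module _ {d} (sf : SquareFree (map letter d)) where

    -- Dropping the `s` whole blocks before the square moves its start into the first block, and a
    -- suffix of a square-free word is square-free.
    noShortSquareAt : ∀ i (q : Fin 18) → ¬ SquareAt (image d) i (suc (toℕ q))
    noShortSquareAt i q (_ , le , eq) with i divMod 18
    ... | result s r refl = noShortSquare-image (drop s d)
      (subst SquareFree (List.drop-map s d) (squareFree-drop s sf)) r q
      bound
      (trans (sym (factor-image (toℕ r) s p d)) (trans eq (trans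
        (cong (λ n → factor n p (image d)) (xy∙z≈xz∙y (toℕ r) (s * 18) p))
        (factor-image (toℕ r + p) s p d))))
      where
      p = suc (toℕ q)
      bound : toℕ r + (p + p) ≤ length (image (drop s d))
      bound = subst (toℕ r + (p + p) ≤_)
        (trans (sym (List.length-drop (s * 18) (image d))) (cong length (drop-image s d)))
        (ℕ.m+n≤o⇒m≤o∸n (toℕ r + (p + p)) (subst (_≤ length (image d)) (xy∙z≈xz∙y (toℕ r) (s * 18) (p + p)) le))

    offset-factor : ∀ s (r : Fin 18) → toℕ r + s * 18 + 19 ≤ length (image d) →
                    offset (steps (factor (toℕ r + s * 18) 19 (image d))) ≡ toℕ r
    offset-factor s r le = trans (cong (λ z → offset (steps z)) (factor-image (toℕ r) s 19 d))
      (offset-image (drop s d) (subst SquareFree (List.drop-map s d) (squareFree-drop s sf)) r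
        (subst (toℕ r + 19 ≤_)
          (trans (sym (List.length-drop (s * 18) (image d))) (cong length (drop-image s d)))
          (ℕ.m+n≤o⇒m≤o∸n (toℕ r + 19) (subst (_≤ length (image d)) (xy∙z≈xz∙y (toℕ r) (s * 18) 19) le))))

    -- Block l ends with the letter l, so the letters of d are read off the image at the
    -- positions 17 + 18 k; each half of an aligned square contains m of these.
    noAlignedSquareAt : ∀ (r : Fin 18) s m → ¬ SquareAt (image d) (toℕ r + s * 18) (m * 18)
    noAlignedSquareAt r s zero ()
    noAlignedSquareAt r s m@(suc _) (_ , le , eq) = sf (squareAt⇒containsSquare (map letter d) s m
      (s≤s z≤n , bound , factor-ext m s (s + m) letters))
      where
      open ≡-Reasoning
      i = toℕ r + s * 18
      W = image d
      -- Distance from the start of the square to the last letter of block `s`; a further `k * 18`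
      -- leads to the last letter of block `s + k`.
      o = 17 ∸ toℕ r
      lem₁ : ∀ r s m → r + s * 18 + (m * 18 + m * 18) ≡ r + (s + (m + m)) * 18
      lem₁ = solve-∀
      lem₂ : ∀ r s o k → r + s * 18 + (o + k * 18) ≡ o + r + (s + k) * 18
      lem₂ = solve-∀
      lem₃ : ∀ r s o k m → r + s * 18 + m * 18 + (o + k * 18) ≡ o + r + (s + m + k) * 18
      lem₃ = solve-∀
      o+r : o + toℕ r ≡ 17
      o+r = ℕ.m∸n+n≡m (s≤s⁻¹ (Fin.toℕ<n r))
      bound : s + (m + m) ≤ length (map letter d)
      bound = subst (s + (m + m) ≤_) (sym (List.length-map letter d))
        (ℕ.*-cancelʳ-≤ (s + (m + m)) (length d) 18
          (ℕ.≤-trans (ℕ.m≤n+m _ (toℕ r)) (subst₂ _≤_ (lem₁ (toℕ r) s m) (length-image d) le)))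
      letters : ∀ k → k < m → factor (s + k) 1 (map letter d) ≡ factor (s + m + k) 1 (map letter d)
      letters k k<m = begin
        factor (s + k) 1 (map letter d)  ≡⟨ sample (s + k) d ⟨
        factor (17 + (s + k) * 18) 1 W   ≡⟨ cong (λ n → factor n 1 W) (trans (lem₂ (toℕ r) s o k) (cong (_+ (s + k) * 18) o+r)) ⟨
        factor (i + (o + k * 18)) 1 W    ≡⟨ factor-cong i (i + m * 18) eq inside ⟩
        factor (i + m * 18 + (o + k * 18)) 1 W ≡⟨ cong (λ n → factor n 1 W) (trans (lem₃ (toℕ r) s o k m) (cong (_+ (s + m + k) * 18) o+r)) ⟩
        factor (17 + (s + m + k) * 18) 1 W     ≡⟨ sample (s + m + k) d ⟩
        factor (s + m + k) 1 (map letter d) ∎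
        where
        -- As `o ≤ 17`, sample `k` lies before `(k + 1) * 18 ≤ m * 18`, so within one half.
        inside : o + k * 18 + 1 ≤ m * 18
        inside = ℕ.≤-trans (ℕ.≤-reflexive (ℕ.+-comm (o + k * 18) 1))
          (ℕ.≤-trans (ℕ.+-monoˡ-≤ (k * 18) (s≤s (ℕ.m∸n≤m 17 (toℕ r)))) (ℕ.*-monoˡ-≤ 18 k<m))

    -- Since `19 ≤ p`, both halves begin with the same window of 19 letters. Its offset is the
    -- residue of `i` and also that of `i + p` modulo 18, so 18 divides `p`.
    noLongSquareAt : ∀ i p → 19 ≤ p → ¬ SquareAt (image d) i p
    noLongSquareAt i p 19≤p sq@(_ , le , eq) with i divMod 18 | (i + p) divMod 18
    ... | result s r refl | result s′ r′ eq′ =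
      noAlignedSquareAt r s (s′ ∸ s) (subst (SquareAt (image d) (toℕ r + s * 18)) p≡ sq)
      where
      open ≡-Reasoning
      i+p+19≤ : i + p + 19 ≤ length (image d)
      i+p+19≤ = ℕ.≤-trans (ℕ.+-monoʳ-≤ (i + p) 19≤p) (subst (_≤ length (image d)) (sym (ℕ.+-assoc i p p)) le)
      r≡r′ : toℕ r ≡ toℕ r′
      r≡r′ = begin
        toℕ r                                    ≡⟨ offset-factor s r (ℕ.≤-trans (ℕ.+-monoˡ-≤ 19 (ℕ.m≤m+n i p)) i+p+19≤) ⟨
        offset (steps (factor i 19 (image d)))   ≡⟨ cong (λ z → offset (steps z)) windows ⟩
        offset (steps (factor (toℕ r′ + s′ * 18) 19 (image d))) ≡⟨ offset-factor s′ r′ (subst (λ n → n + 19 ≤ length (image d)) eq′ i+p+19≤) ⟩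
        toℕ r′ ∎
        where
        windows : factor i 19 (image d) ≡ factor (toℕ r′ + s′ * 18) 19 (image d)
        windows = subst₂ (λ a b → factor a 19 (image d) ≡ factor b 19 (image d)) (ℕ.+-identityʳ i)
          (trans (ℕ.+-identityʳ (i + p)) eq′) (factor-cong i (i + p) eq 19≤p)
      shift : s * 18 + p ≡ s′ * 18
      shift = ℕ.+-cancelˡ-≡ (toℕ r) _ _ (trans (sym (ℕ.+-assoc (toℕ r) (s * 18) p)) (trans eq′ (cong (_+ s′ * 18) (sym r≡r′))))
      p≡ : p ≡ (s′ ∸ s) * 18
      p≡ = begin
        p                         ≡⟨ ℕ.m+n∸m≡n (s * 18) p ⟨
        s * 18 + p ∸ s * 18       ≡⟨ cong (_∸ s * 18) shift ⟩
        s′ * 18 ∸ s * 18          ≡⟨ ℕ.*-distribʳ-∸ 18 s′ s ⟨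
        (s′ ∸ s) * 18             ∎

    squareFree-image : SquareFree (image d)
    squareFree-image c with containsSquare⇒squareAt c
    ... | i , zero , () , _
    ... | i , p@(suc q) , sq with p ℕ.≤? 18
    ...   | yes p≤18 = noShortSquareAt i (fromℕ< p≤18)
              (subst (SquareAt (image d) i) (cong suc (sym (Fin.toℕ-fromℕ< p≤18))) sq)
    ...   | no  p≰18 = noLongSquareAt i p (ℕ.≰⇒> p≰18) sq

  -- Counting square-free words.

  length-injection : ∀ {A B : Set} {xs : List A} {ys : List B} (f : A → B) → Unique xs →
                     (∀ {x} → x ∈ xs → f x ∈ ys) →
                     (∀ {x y} → x ∈ xs → y ∈ xs → f x ≡ f y → x ≡ y) →
                     length xs ≤ length ys
  length-injection {xs = []}     f _            _  _   = z≤n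
  length-injection {xs = x ∷ xs} f (x∉xs ∷ uniq) f∈ inj with ∈-∃++ (f∈ (here refl))
  ... | us , vs , refl = begin
    suc (length xs)              ≤⟨ s≤s (length-injection f uniq f∈′ λ p q → inj (there p) (there q)) ⟩
    suc (length (us ++ vs))      ≡⟨ cong suc (List.length-++ us) ⟩
    suc (length us + length vs)  ≡⟨ ℕ.+-suc (length us) (length vs) ⟨
    length us + suc (length vs)  ≡⟨ List.length-++ us ⟨
    length (us ++ f x ∷ vs)      ∎
    where
    open ℕ.≤-Reasoning
    -- By injectivity no remaining element is sent to `f x`, so their images survive its removal
    -- from `ys`.
    f∈′ : ∀ {y} → y ∈ xs → f y ∈ us ++ vs
    f∈′ {y} y∈ with ∈-++⁻ us (f∈ (there y∈))
    ... | inj₁ p           = ∈-++⁺ˡ p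
    ... | inj₂ (there p)   = ∈-++⁺ʳ us p
    ... | inj₂ (here fy≡fx) = contradiction (inj (here refl) (there y∈) (sym fy≡fx)) (All.lookup x∉xs y∈)

  length-cartesianProductWith : ∀ {A B C : Set} (f : A → B → C) xs ys →
                                length (cartesianProductWith f xs ys) ≡ length xs * length ys
  length-cartesianProductWith f []       ys = refl
  length-cartesianProductWith f (x ∷ xs) ys = trans (List.length-++ (map (f x) ys))
    (cong₂ _+_ (List.length-map (f x) ys) (length-cartesianProductWith f xs ys))

  -- Generalises `words` to any alphabet, so that one proof of counting and uniqueness serves both
  -- words and sequences of binary choices.
  tuples : ∀ {A : Set} → List A → ℕ → List (List A)
  tuples xs zero    = [] ∷ []
  tuples xs (suc n) = cartesianProductWith _∷_ xs (tuples xs n)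

  length-tuples : ∀ {A : Set} (xs : List A) n → length (tuples xs n) ≡ length xs ^ n
  length-tuples xs zero    = refl
  length-tuples xs (suc n) = trans (length-cartesianProductWith _∷_ xs (tuples xs n))
    (cong (length xs *_) (length-tuples xs n))

  tuples-unique : ∀ {A : Set} {xs : List A} n → Unique xs → Unique (tuples xs n)
  tuples-unique zero    _    = All.[] ∷ []
  tuples-unique (suc n) uniq = Unique.cartesianProductWith⁺ _∷_ List.∷-injective uniq (tuples-unique n uniq)

  ∈-tuples⁻ : ∀ {A : Set} (xs : List A) n {w} → w ∈ tuples xs n → length w ≡ n
  ∈-tuples⁻ xs zero    (here refl) = refl
  ∈-tuples⁻ xs (suc n) w∈ with ∈-cartesianProductWith⁻ _∷_ xs (tuples xs n) w∈
  ... | _ , _ , _ , v∈ , refl = cong suc (∈-tuples⁻ xs n v∈)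

  words≡tuples : ∀ n → words n ≡ tuples (allFin 3) n
  words≡tuples zero    = refl
  words≡tuples (suc n) = cong (cartesianProductWith _∷_ (allFin 3)) (words≡tuples n)

  ∈-words⁺ : ∀ w → w ∈ words (length w)
  ∈-words⁺ []      = here refl
  ∈-words⁺ (c ∷ w) = ∈-cartesianProductWith⁺ _∷_ (∈-allFin c) (∈-words⁺ w)

  squareFreeWords : ℕ → List Word
  squareFreeWords n = filter squareFree? (words n)

  squareFreeWords-unique : ∀ n → Unique (squareFreeWords n)
  squareFreeWords-unique n = Unique.filter⁺ squareFree?
    (subst Unique (sym (words≡tuples n)) (tuples-unique n (Unique.allFin⁺ 3)))

  ∈-squareFreeWords⁺ : ∀ {n w} → length w ≡ n → SquareFree w → w ∈ squareFreeWords n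
  ∈-squareFreeWords⁺ {w = w} refl = ∈-filter⁺ squareFree? (∈-words⁺ w)

  ∈-squareFreeWords⁻ : ∀ {n w} → w ∈ squareFreeWords n → length w ≡ n × SquareFree w
  ∈-squareFreeWords⁻ {n} {w} w∈ with ∈-filter⁻ squareFree? w∈
  ... | w∈words , sf = ∈-tuples⁻ (allFin 3) n (subst (w ∈_) (words≡tuples n) w∈words) , sf

  a≤3^n : ∀ n → a n ≤ 3 ^ n
  a≤3^n n = ℕ.≤-trans (List.length-filter squareFree? (words n))
    (ℕ.≤-reflexive (trans (cong length (words≡tuples n)) (length-tuples (allFin 3) n)))

  -- A word is determined by its prefix of length `m` and the remaining suffix, and both inherit
  -- square-freeness.
  a-submultiplicative : ∀ m n → a (m + n) ≤ a m * a n
  a-submultiplicative m n = subst (a (m + n) ≤_)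
    (length-cartesianProductWith _,_ (squareFreeWords m) (squareFreeWords n))
    (length-injection split (squareFreeWords-unique (m + n)) split∈ λ _ _ → split-injective)
    where
    split : Word → Word × Word
    split w = take m w , drop m w

    split-injective : ∀ {v w} → split v ≡ split w → v ≡ w
    split-injective {v} {w} eq with ,-injective eq
    ... | eq₁ , eq₂ = trans (sym (List.take++drop≡id m v)) (trans (cong₂ _++_ eq₁ eq₂) (List.take++drop≡id m w))

    split∈ : ∀ {w} → w ∈ squareFreeWords (m + n) → split w ∈ cartesianProduct (squareFreeWords m) (squareFreeWords n)
    split∈ {w} w∈ with ∈-squareFreeWords⁻ w∈
    ... | len , sf = ∈-cartesianProduct⁺
      (∈-squareFreeWords⁺ (trans (List.length-take m w) (ℕ.m≤n⇒m⊓n≡m (subst (m ≤_) (sym len) (ℕ.m≤m+n m n))))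
        (squareFree-++⁻ [] (take m w) (subst SquareFree (sym (List.take++drop≡id m w)) sf)))
      (∈-squareFreeWords⁺ (trans (List.length-drop m w) (trans (cong (_∸ m) len) (ℕ.m+n∸m≡n m n)))
        (squareFree-drop m sf))

  a-* : ∀ k n → a (k * n) ≤ a n ^ k
  a-* zero    n = ℕ.≤-refl
  a-* (suc k) n = ℕ.≤-trans (a-submultiplicative n (k * n)) (ℕ.*-monoʳ-≤ (a n) (a-* k n))

  ++-injective : ∀ {A : Set} (x x′ : List A) {y y′} → length x ≡ length x′ → x ++ y ≡ x′ ++ y′ → x ≡ x′ × y ≡ y′
  ++-injective []      []        _   eq = refl , eq
  ++-injective (c ∷ x) (c′ ∷ x′) len eq with List.∷-injective eq
  ... | refl , eq′ with ++-injective x x′ (ℕ.suc-injective len) eq′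
  ...   | refl , eq″ = refl , eq″

  block-injective : ∀ e f → block e ≡ block f → e ≡ f
  block-injective = from-yes (allSymbols? λ e → allSymbols? λ f →
    ≡-dec Fin._≟_ (block e) (block f) →-dec ×.≡-dec Fin._≟_ Fin._≟_ e f)

  image-injective : ∀ {d d′} → length d ≡ length d′ → image d ≡ image d′ → d ≡ d′
  image-injective {[]}    {[]}      _   _  = refl
  image-injective {e ∷ d} {e′ ∷ d′} len eq
    with ++-injective (block e) (block e′) (trans (length-block e) (sym (length-block e′))) eq
  ... | eq₁ , eq₂ = cong₂ _∷_ (block-injective e e′ eq₁) (image-injective (ℕ.suc-injective len) eq₂)

  length-zip : ∀ {A B : Set} {n} (xs : List A) (ys : List B) → length xs ≡ n → length ys ≡ n → length (zip xs ys) ≡ n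
  length-zip {n = n} xs ys lx ly = trans (List.length-zipWith _,_ xs ys) (trans (cong₂ _⊓_ lx ly) (ℕ.⊓-idem n))

  map-proj₁-zip : ∀ {A B : Set} (xs : List A) (ys : List B) → length xs ≡ length ys → map proj₁ (zip xs ys) ≡ xs
  map-proj₁-zip []       []       _   = refl
  map-proj₁-zip (x ∷ xs) (y ∷ ys) len = cong (x ∷_) (map-proj₁-zip xs ys (ℕ.suc-injective len))

  map-proj₂-zip : ∀ {A B : Set} (xs : List A) (ys : List B) → length xs ≡ length ys → map proj₂ (zip xs ys) ≡ ys
  map-proj₂-zip []       []       _   = refl
  map-proj₂-zip (x ∷ xs) (y ∷ ys) len = cong (y ∷_) (map-proj₂-zip xs ys (ℕ.suc-injective len))

  -- The `n` blocks are chosen independently, two ways each, and the image reveals both the word and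
  -- the choices. Decoding needs equal lengths, which is why `length-injection` asks for injectivity
  -- on members only.
  a-growth : ∀ n → a n * 2 ^ n ≤ a (n * 18)
  a-growth n = subst (_≤ a (n * 18))
    (trans (length-cartesianProductWith _,_ (squareFreeWords n) choices) (cong (a n *_) (length-tuples (allFin 2) n)))
    (length-injection encode
      (Unique.cartesianProduct⁺ (squareFreeWords-unique n) (tuples-unique n (Unique.allFin⁺ 2)))
      encode∈ encode-injective)
    where
    choices = tuples (allFin 2) n

    encode : Word × List (Fin 2) → Word
    encode (w , c) = image (zip w c)

    Sources = cartesianProduct (squareFreeWords n) choices

    lengths : ∀ {w c} → (w , c) ∈ Sources → length w ≡ n × length c ≡ n × SquareFree w
    lengths wc∈ with ∈-cartesianProduct⁻ (squareFreeWords n) choices wc∈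
    ... | w∈ , c∈ with ∈-squareFreeWords⁻ w∈
    ...   | len , sf = len , ∈-tuples⁻ (allFin 2) n c∈ , sf

    encode∈ : ∀ {wc} → wc ∈ Sources → encode wc ∈ squareFreeWords (n * 18)
    encode∈ {w , c} wc∈ with lengths wc∈
    ... | lw , lc , sf = ∈-squareFreeWords⁺
      (trans (length-image (zip w c)) (cong (_* 18) (length-zip w c lw lc)))
      (squareFree-image (subst SquareFree (sym (map-proj₁-zip w c (trans lw (sym lc)))) sf))

    encode-injective : ∀ {wc wc′} → wc ∈ Sources → wc′ ∈ Sources → encode wc ≡ encode wc′ → wc ≡ wc′
    encode-injective {w , c} {w′ , c′} wc∈ wc′∈ eq with lengths wc∈ | lengths wc′∈
    ... | lw , lc , _ | lw′ , lc′ , _ = cong₂ _,_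
      (trans (sym (map-proj₁-zip w c l)) (trans (cong (map proj₁) zips) (map-proj₁-zip w′ c′ l′)))
      (trans (sym (map-proj₂-zip w c l)) (trans (cong (map proj₂) zips) (map-proj₂-zip w′ c′ l′)))
      where
      l  = trans lw (sym lc)
      l′ = trans lw′ (sym lc′)
      zips : zip w c ≡ zip w′ c′
      zips = image-injective (trans (length-zip w c lw lc) (sym (length-zip w′ c′ lw′ lc′))) eq

  -- Starting from length 1, the construction multiplies the length by 18 and keeps the count
  -- positive.
  a-positive-beyond : ∀ n → ∃ λ N → n < N × 0 < a N
  a-positive-beyond zero    = 1 , s≤s z≤n , s≤s z≤n
  a-positive-beyond (suc n) with a-positive-beyond n
  ... | N , n<N , 0<aN = N * 18 ,
    ℕ.≤-<-trans n<N (ℕ.m<m*n N 18 {{>-nonZero (ℕ.≤-<-trans z≤n n<N)}} (s≤s (s≤s z≤n))) ,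
    ℕ.<-≤-trans (ℕ.*-mono-< 0<aN (ℕ.m^n>0 2 N)) (a-growth N)

  -- If `a n` vanished, submultiplicativity would make `a` vanish at every larger length.
  a-positive : ∀ n → 0 < a n
  a-positive n with a-positive-beyond n
  ... | N , n<N , 0<aN with ℕ.m≤n⇒∃[o]m+o≡n (ℕ.<⇒≤ n<N)
  ...   | o , refl = ℕ.n≢0⇒n>0 λ an≡0 → ℕ.<⇒≱ 0<aN
    (subst (a (n + o) ≤_) (cong (_* a o) an≡0) (a-submultiplicative n o))

  2^n≤a^17 : ∀ n → 2 ^ n ≤ a n ^ 17
  2^n≤a^17 n = ℕ.*-cancelˡ-≤ (a n) {{>-nonZero (a-positive n)}} (begin
    a n * 2 ^ n   ≤⟨ a-growth n ⟩
    a (n * 18)    ≡⟨ cong a (ℕ.*-comm n 18) ⟩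
    a (18 * n)    ≤⟨ a-* 18 n ⟩
    a n ^ 18      ∎)
    where open ℕ.≤-Reasoning

module Growth where

  open Words using (a≤3^n; a-submultiplicative; a-*; a-positive; 2^n≤a^17)
  open ℚ-Powers
  open import Algebra.Bundles using (CommutativeRing)
  open import Data.Integer.Base as ℤ using (+_; -[1+_])
  import Data.Integer.Properties as ℤ
  open import Data.Nat.Base as ℕ using (zero; suc; NonZero)
  import Data.Nat.Properties as ℕ
  import Data.Nat.Coprimality as Coprimality
  open import Data.Nat.DivMod using (_%_; _/_; m≡m%n+[m/n]*n; m%n<n)
  open import Data.Product using (∃-syntax; _,_; proj₁)
  open import Data.Rational.Base as ℚ
    using (ℚ; mkℚ; 0ℚ; 1ℚ; _+_; _*_; _-_; -_; _≤_; _<_; *≤*; *<*; ↥_)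
  import Data.Rational.Properties as ℚ
  open import Data.Sum.Base using (_⊎_; inj₁; inj₂)
  open import Relation.Binary.PropositionalEquality
    using (_≡_; refl; sym; trans; cong; cong₂; subst; subst₂; module ≡-Reasoning)
  open import Relation.Nullary using (Dec; yes; no; contradiction)
  open import Algebra.Properties.CommutativeSemiring.Exp
    (CommutativeRing.commutativeSemiring ℚ.+-*-commutativeRing)
    using (^-homo-*; ^-assocʳ; ^-distrib-*)
  open import Algebra.Properties.Group ℚ.+-0-group using (//-rightDividesˡ; //-rightDividesʳ)

  -- Rational arithmetic: embedding of the naturals, Archimedean property, Bernoulli.

  ℕ→ℚ-mkℚ : ∀ n → ℕ→ℚ n ≡ mkℚ (+ n) 0 (Coprimality.sym (Coprimality.1-coprimeTo n))
  ℕ→ℚ-mkℚ n = ℚ.fromℚᵘ-toℚᵘ (mkℚ (+ n) 0 (Coprimality.sym (Coprimality.1-coprimeTo n)))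

  ℕ→ℚ-mono-≤ : ∀ {m n} → m ℕ.≤ n → ℕ→ℚ m ≤ ℕ→ℚ n
  ℕ→ℚ-mono-≤ {m} {n} m≤n = subst₂ _≤_ (sym (ℕ→ℚ-mkℚ m)) (sym (ℕ→ℚ-mkℚ n))
    (*≤* (subst₂ ℤ._≤_ (sym (ℤ.*-identityʳ (+ m))) (sym (ℤ.*-identityʳ (+ n))) (ℤ.+≤+ m≤n)))

  ℕ→ℚ-* : ∀ m n → ℕ→ℚ (m ℕ.* n) ≡ ℕ→ℚ m * ℕ→ℚ n
  ℕ→ℚ-* m n = trans (ℚ./-cong (ℤ.pos-* m n) refl) (sym (cong₂ _*_ (ℕ→ℚ-mkℚ m) (ℕ→ℚ-mkℚ n)))

  ℕ→ℚ-suc : ∀ n → ℕ→ℚ (suc n) ≡ 1ℚ + ℕ→ℚ n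
  ℕ→ℚ-suc n = trans (ℚ./-cong (cong (ℤ._+_ (+ 1)) (sym (ℤ.*-identityʳ (+ n)))) refl) (cong (_+_ 1ℚ) (sym (ℕ→ℚ-mkℚ n)))

  ℕ→ℚ-^ : ∀ m k → ℕ→ℚ (m ℕ.^ k) ≡ ℕ→ℚ m ^ℚ k
  ℕ→ℚ-^ m zero    = refl
  ℕ→ℚ-^ m (suc k) = trans (ℕ→ℚ-* m (m ℕ.^ k)) (cong (ℕ→ℚ m *_) (ℕ→ℚ-^ m k))

  archimedean : ∀ x {δ} → 0ℚ < δ → ∃[ N ] x < ℕ→ℚ N * δ
  archimedean x {δ} 0<δ with quotient x 0<δ
  -- Here `y` is `x` divided by `δ`; its denominator is at least 1, so it is less than one plus the
  -- absolute value of its numerator.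
  ... | y , refl = suc ℤ.∣ ↥ y ∣ , *-mono-<ˡ 0<δ (y< y)
    where
    y< : ∀ y → y < ℕ→ℚ (suc ℤ.∣ ↥ y ∣)
    y< (mkℚ (+ p) d-1 c) = subst (mkℚ (+ p) d-1 c <_) (sym (ℕ→ℚ-mkℚ (suc p)))
      (*<* (subst₂ ℤ._<_ (sym (ℤ.*-identityʳ (+ p))) (ℤ.pos-* (suc p) (suc d-1)) (ℤ.+<+ (ℕ.m≤m*n (suc p) (suc d-1)))))
    y< (mkℚ -[1+ p ] d-1 c) = subst (mkℚ -[1+ p ] d-1 c <_) (sym (ℕ→ℚ-mkℚ (suc (suc p)))) (*<* ℤ.-<+)

  bernoulli : ∀ n {d} → 0ℚ ≤ d → 1ℚ + ℕ→ℚ n * d ≤ (1ℚ + d) ^ℚ n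
  bernoulli zero    {d} 0≤d = ℚ.≤-reflexive (trans (cong (_+_ 1ℚ) (ℚ.*-zeroˡ d)) (ℚ.+-identityʳ 1ℚ))
  bernoulli (suc n) {d} 0≤d = begin
    1ℚ + ℕ→ℚ (suc n) * d             ≡⟨ cong (λ x → 1ℚ + x * d) (ℕ→ℚ-suc n) ⟩
    1ℚ + (1ℚ + ℕ→ℚ n) * d            ≡⟨ cong (_+_ 1ℚ) (trans (ℚ.*-distribʳ-+ d 1ℚ (ℕ→ℚ n)) (cong (_+ x) (ℚ.*-identityˡ d))) ⟩
    1ℚ + (d + x)                     ≡⟨ ℚ.+-assoc 1ℚ d x ⟨
    1ℚ + d + x                       ≤⟨ ℚ.+-monoʳ-≤ (1ℚ + d) (subst (_≤ (1ℚ + d) * x) (ℚ.*-identityˡ x) (*-mono-≤ 0≤x 0≤1+d 1≤1+d ℚ.≤-refl)) ⟩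
    1ℚ + d + (1ℚ + d) * x            ≡⟨ cong (_+ (1ℚ + d) * x) (ℚ.*-identityʳ (1ℚ + d)) ⟨
    (1ℚ + d) * 1ℚ + (1ℚ + d) * x     ≡⟨ ℚ.*-distribˡ-+ (1ℚ + d) 1ℚ x ⟨
    (1ℚ + d) * (1ℚ + x)              ≤⟨ *-mono-≤ (ℚ.≤-trans (ℚ.nonNegative⁻¹ 1ℚ) (ℚ.≤-trans (ℚ.≤-reflexive (sym (ℚ.+-identityʳ 1ℚ))) (ℚ.+-monoʳ-≤ 1ℚ 0≤x))) 0≤1+d ℚ.≤-refl (bernoulli n 0≤d) ⟩
    (1ℚ + d) * (1ℚ + d) ^ℚ n         ∎
    where
    open ℚ.≤-Reasoning
    x = ℕ→ℚ n * d
    0≤x : 0ℚ ≤ x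
    0≤x = *-nonNeg (0≤ℕ→ℚ n) 0≤d
    1≤1+d : 1ℚ ≤ 1ℚ + d
    1≤1+d = subst (_≤ 1ℚ + d) (ℚ.+-identityʳ 1ℚ) (ℚ.+-monoʳ-≤ 1ℚ 0≤d)
    0≤1+d = ℚ.≤-trans (ℚ.nonNegative⁻¹ 1ℚ) 1≤1+d

  -- Lower bounds for `a n` and for the limit.

  2^n≤a^17ℚ : ∀ n → ℕ→ℚ 2 ^ℚ n ≤ ℕ→ℚ (a n) ^ℚ 17
  2^n≤a^17ℚ n = subst₂ _≤_ (ℕ→ℚ-^ 2 n) (ℕ→ℚ-^ (a n) 17) (ℕ→ℚ-mono-≤ (2^n≤a^17 n))

  2^[n/17]≤a : ∀ n → 2 ^[ n / 17 ] ≤ᴿ fromℕ (a n)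
  2^[n/17]≤a n (inj₁ q<0) = ℚ.<-≤-trans q<0 (0≤ℕ→ℚ (a n))
  2^[n/17]≤a n {q} (inj₂ q^17<2^n) = ℚ.≰⇒> λ a≤q → ℚ.<-irrefl refl (begin-strict
    q ^ℚ 17               <⟨ q^17<2^n ⟩
    ℕ→ℚ (2 ℕ.^ n)         ≡⟨ ℕ→ℚ-^ 2 n ⟩
    ℕ→ℚ 2 ^ℚ n            ≤⟨ 2^n≤a^17ℚ n ⟩
    ℕ→ℚ (a n) ^ℚ 17       ≤⟨ ^-mono-≤ 17 (0≤ℕ→ℚ (a n)) a≤q ⟩
    q ^ℚ 17               ∎)
    where open ℚ.≤-Reasoning

  -- If `t < r`, then `a(n)^17 < t^(17n) ≤ 2^n`, against `2^n≤a^17`. The rational form fits `_<ᴿ_`,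
  -- which supplies a rational above `growth n`.
  2^[1/17]≤growth : ∀ n .{{_ : NonZero n}} {r t} → L (2 ^[ 1 / 17 ]) r → U (growth n) t → r ≤ t
  2^[1/17]≤growth n {r} {t} (inj₁ r<0) (0<t , _) = ℚ.<⇒≤ (ℚ.<-trans r<0 0<t)
  2^[1/17]≤growth n {r} {t} (inj₂ r^17<2) (0<t , a<t^n) = ℚ.≮⇒≥ λ t<r → ℚ.<-irrefl refl (begin-strict
    ℕ→ℚ 2 ^ℚ n            ≤⟨ 2^n≤a^17ℚ n ⟩
    ℕ→ℚ (a n) ^ℚ 17       <⟨ ^-mono-< 17 (0≤ℕ→ℚ (a n)) (subst (λ b → ℕ→ℚ b < t ^ℚ n) (ℕ.^-identityʳ (a n)) a<t^n) ⟩
    (t ^ℚ n) ^ℚ 17        ≡⟨ trans (^-assocʳ t n 17) (trans (cong (t ^ℚ_) (ℕ.*-comm n 17)) (sym (^-assocʳ t 17 n))) ⟩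
    (t ^ℚ 17) ^ℚ n        ≤⟨ ^-mono-≤ n (^-nonNeg 17 0≤t) (ℚ.≤-trans (^-mono-≤ 17 0≤t (ℚ.<⇒≤ t<r)) (ℚ.<⇒≤ r^17<2)) ⟩
    ℕ→ℚ 2 ^ℚ n            ∎)
    where
    open ℚ.≤-Reasoning
    0≤t = ℚ.<⇒≤ 0<t

  p<q⇒0<q-p : ∀ {p q} → p < q → 0ℚ < q - p
  p<q⇒0<q-p {p} {q} p<q = subst (_< q - p) (ℚ.+-inverseʳ p) (ℚ.+-monoˡ-< (- p) p<q)

  p+[q-p]≡q : ∀ p q → p + (q - p) ≡ q
  p+[q-p]≡q p q = trans (ℚ.+-comm p (q - p)) (//-rightDividesˡ p q)

  -- Choose `q < m < r` with `r` below the root and put `ε = r - m`. A late term has a rational `t`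
  -- above it with `t - ε` below `μ`; as `r ≤ t`, it follows that `q < m ≤ t - ε`.
  2^[1/17]≤limit : ∀ μ → growth ⟶ μ → 2 ^[ 1 / 17 ] ≤ᴿ μ
  2^[1/17]≤limit μ lim {q} q∈L =
    let r , q<r , r∈L = L-open (2 ^[ 1 / 17 ]) q∈L
        m , q<m , m<r = ℚ.<-dense q<r
        N , close     = lim (r - m) (p<q⇒0<q-p m<r)
    -- The index is `suc N` because the sequence starts at 1 and `N` may be 0.
    in  below-limit r∈L q<m (suc N) (proj₁ (close (suc N) (ℕ.n≤1+n N)))
    where
    below-limit : ∀ {r m} → L (2 ^[ 1 / 17 ]) r → q < m →
                  ∀ n .{{_ : NonZero n}} → growth n <ᴿ μ +ᴿ (r - m) → L μ q
    below-limit {r} {m} r∈L q<m n (t , t∈U , t-ε∈L) = L-lower μ (ℚ.<-≤-trans q<m m≤t-ε) t-ε∈L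
      where
      m≤t-ε : m ≤ t - (r - m)
      m≤t-ε = subst (_≤ t - (r - m)) (//-rightDividesʳ (r - m) m)
        (ℚ.+-monoˡ-≤ (- (r - m)) (subst (_≤ t) (sym (p+[q-p]≡q m r)) (2^[1/17]≤growth n r∈L t∈U)))

  -- Existence of the limit, as the infimum of the roots.

  approximate : ∀ (x : ℝ) {δ} → 0ℚ < δ → ∃[ q ] (L x q × U x (q + (δ + δ)))
  approximate x {δ} 0<δ with L-inhabited x | U-inhabited x
  ... | l , l∈L | u , u∈U with archimedean (u - l) 0<δ
  ... | N , u-l<Nδ = walk N l l∈L (U-upper x (subst (_< l + ℕ→ℚ N * δ) (p+[q-p]≡q l u) (ℚ.+-monoʳ-< l u-l<Nδ)) u∈U)
    where
    step : ∀ q n → q + ℕ→ℚ (suc n) * δ ≡ q + δ + ℕ→ℚ n * δ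
    step q n = begin
      q + ℕ→ℚ (suc n) * δ          ≡⟨ cong (λ z → q + z * δ) (ℕ→ℚ-suc n) ⟩
      q + (1ℚ + ℕ→ℚ n) * δ         ≡⟨ cong (_+_ q) (ℚ.*-distribʳ-+ δ 1ℚ (ℕ→ℚ n)) ⟩
      q + (1ℚ * δ + ℕ→ℚ n * δ)     ≡⟨ cong (λ z → q + (z + ℕ→ℚ n * δ)) (ℚ.*-identityˡ δ) ⟩
      q + (δ + ℕ→ℚ n * δ)          ≡⟨ ℚ.+-assoc q δ (ℕ→ℚ n * δ) ⟨
      q + δ + ℕ→ℚ n * δ            ∎
      where open ≡-Reasoning
    -- Invariant: `q` lies below `x` and `q + N δ` above it. Locating `x` against `q + δ < q + 2δ`
    -- either advances `q` by `δ` or finishes; at `N = 0` the point `q` would lie on both sides.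
    walk : ∀ N q → L x q → U x (q + ℕ→ℚ N * δ) → ∃[ q ] (L x q × U x (q + (δ + δ)))
    walk zero    q q∈L q∈U = contradiction (q∈L , subst (U x) (trans (cong (_+_ q) (ℚ.*-zeroˡ δ)) (ℚ.+-identityʳ q)) q∈U) (disjoint x)
    walk (suc N) q q∈L h with located x (ℚ.+-monoʳ-< q (subst (_< δ + δ) (ℚ.+-identityʳ δ) (ℚ.+-monoʳ-< δ 0<δ)))
    ... | inj₁ q+δ∈L  = walk N (q + δ) q+δ∈L (subst (U x) (step q N) h)
    ... | inj₂ q+2δ∈U = q , q∈L , q+2δ∈U

  1^ : ∀ n → 1ℚ ^ℚ n ≡ 1ℚ
  1^ zero    = refl
  1^ (suc n) = trans (ℚ.*-identityˡ _) (1^ n)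

  1≤a : ∀ n → 1ℚ ≤ ℕ→ℚ (a n)
  1≤a n = ℕ→ℚ-mono-≤ (a-positive n)

  1≤base : ∀ m {u} → 0ℚ < u → ℕ→ℚ (a m) < u ^ℚ m → 1ℚ ≤ u
  1≤base m {u} 0<u am<u^m = ℚ.≮⇒≥ λ u<1 → ℚ.<-irrefl refl (begin-strict
    1ℚ            ≤⟨ 1≤a m ⟩
    ℕ→ℚ (a m)     <⟨ am<u^m ⟩
    u ^ℚ m        ≤⟨ ^-mono-≤ m (ℚ.<⇒≤ 0<u) (ℚ.<⇒≤ u<1) ⟩
    1ℚ ^ℚ m       ≡⟨ 1^ m ⟩
    1ℚ            ∎)
    where open ℚ.≤-Reasoning

  a-remainder : ∀ m s k → s ℕ.≤ m → a (s ℕ.+ k ℕ.* m) ℕ.≤ 3 ℕ.^ m ℕ.* a m ℕ.^ k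
  a-remainder m s k s≤m = ℕ.≤-trans (a-submultiplicative s (k ℕ.* m))
    (ℕ.*-mono-≤ (ℕ.≤-trans (a≤3^n s) (ℕ.^-monoʳ-≤ 3 s≤m)) (a-* k m))

  -- Fekete's division `n = s + k m` with `s < m`: the remainder costs at most `3^s ≤ 3^m`, a
  -- constant independent of `n`, and the rest at most `u^(km)`. Since `a m ≥ 1` forces `u ≥ 1`,
  -- this power is at most `u^n`.
  a≤3^m*u^n : ∀ m .{{_ : NonZero m}} {u} → 0ℚ < u → ℕ→ℚ (a m) < u ^ℚ m →
              ∀ n → ℕ→ℚ (a n) ≤ ℕ→ℚ (3 ℕ.^ m) * u ^ℚ n
  a≤3^m*u^n m {u} 0<u am<u^m n =
    subst (λ n → ℕ→ℚ (a n) ≤ C * u ^ℚ n) (sym (m≡m%n+[m/n]*n n m)) (bound (n % m) (n / m) (ℕ.<⇒≤ (m%n<n n m)))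
    where
    open ℚ.≤-Reasoning
    C = ℕ→ℚ (3 ℕ.^ m)
    0≤C = 0≤ℕ→ℚ (3 ℕ.^ m)
    0≤u = ℚ.<⇒≤ 0<u
    bound : ∀ s k → s ℕ.≤ m → ℕ→ℚ (a (s ℕ.+ k ℕ.* m)) ≤ C * u ^ℚ (s ℕ.+ k ℕ.* m)
    bound s k s≤m = begin
      ℕ→ℚ (a (s ℕ.+ k ℕ.* m))          ≤⟨ ℕ→ℚ-mono-≤ (a-remainder m s k s≤m) ⟩
      ℕ→ℚ (3 ℕ.^ m ℕ.* a m ℕ.^ k)      ≡⟨ trans (ℕ→ℚ-* (3 ℕ.^ m) (a m ℕ.^ k)) (cong (C *_) (ℕ→ℚ-^ (a m) k)) ⟩
      C * ℕ→ℚ (a m) ^ℚ k               ≤⟨ *-mono-≤ (^-nonNeg k (0≤ℕ→ℚ (a m))) 0≤C ℚ.≤-refl (^-mono-≤ k (0≤ℕ→ℚ (a m)) (ℚ.<⇒≤ am<u^m)) ⟩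
      C * (u ^ℚ m) ^ℚ k                ≡⟨ cong (C *_) (trans (^-assocʳ u m k) (trans (cong (u ^ℚ_) (ℕ.*-comm m k)) (sym (ℚ.*-identityˡ _)))) ⟩
      C * (1ℚ * u ^ℚ (k ℕ.* m))        ≤⟨ *-mono-≤ (*-nonNeg (ℚ.nonNegative⁻¹ 1ℚ) 0≤u^km) 0≤C ℚ.≤-refl
                                            (*-mono-≤ 0≤u^km (^-nonNeg s 0≤u) (1≤^ s (1≤base m 0<u am<u^m)) ℚ.≤-refl) ⟩
      C * (u ^ℚ s * u ^ℚ (k ℕ.* m))    ≡⟨ cong (C *_) (^-homo-* u s (k ℕ.* m)) ⟨
      C * u ^ℚ (s ℕ.+ k ℕ.* m)         ∎
      where 0≤u^km = ^-nonNeg (k ℕ.* m) 0≤u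

  -- Write `t = z u` with `z > 1`; by Bernoulli `z^n` exceeds `n (z - 1)`, which passes `C` by the
  -- Archimedean property.
  exponential-dominates : ∀ C {u t} → 0ℚ < u → u < t → ∃[ N ] (∀ n → N ℕ.≤ n → C * u ^ℚ n < t ^ℚ n)
  exponential-dominates C {u} {t} 0<u u<t with quotient t 0<u
  ... | z , refl with archimedean C (p<q⇒0<q-p {1ℚ} {z} (cancel-< 0<u (subst (_< z * u) (sym (ℚ.*-identityˡ u)) u<t)))
  ... | N , C<Nd = N , λ n N≤n → subst (C * u ^ℚ n <_) (sym (^-distrib-* z u n)) (*-mono-<ˡ (^-pos n 0<u) (begin-strict
    C                             <⟨ C<Nd ⟩
    ℕ→ℚ N * (z - 1ℚ)              ≤⟨ *-mono-≤ 0≤d (0≤ℕ→ℚ n) (ℕ→ℚ-mono-≤ N≤n) ℚ.≤-refl ⟩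
    ℕ→ℚ n * (z - 1ℚ)              ≡⟨ ℚ.+-identityˡ _ ⟨
    0ℚ + ℕ→ℚ n * (z - 1ℚ)         ≤⟨ ℚ.+-monoˡ-≤ (ℕ→ℚ n * (z - 1ℚ)) (ℚ.nonNegative⁻¹ 1ℚ) ⟩
    1ℚ + ℕ→ℚ n * (z - 1ℚ)         ≤⟨ bernoulli n 0≤d ⟩
    (1ℚ + (z - 1ℚ)) ^ℚ n          ≡⟨ cong (_^ℚ n) (p+[q-p]≡q 1ℚ z) ⟩
    z ^ℚ n                        ∎))
    where
    open ℚ.≤-Reasoning
    0≤d = ℚ.<⇒≤ (p<q⇒0<q-p {1ℚ} {z} (cancel-< 0<u (subst (_< z * u) (sym (ℚ.*-identityˡ u)) u<t)))

  -- The witness `r` strictly above `q` makes the lower cut open by density, and lets negative `q`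
  -- be treated like the others.
  Below Above : ℚ → Set
  Below q = ∃[ r ] (q < r × 0ℚ ≤ r × (∀ n → r ^ℚ n ≤ ℕ→ℚ (a n)))
  Above q = ∃[ n ] (0ℚ < q × ℕ→ℚ (a n) < q ^ℚ n)

  1^n≤a : ∀ n → 1ℚ ^ℚ n ≤ ℕ→ℚ (a n)
  1^n≤a n = ℚ.≤-trans (ℚ.≤-reflexive (1^ n)) (1≤a n)

  -- The infimum of a(n)^(1/n) over n ≥ 1 (n = 0 is harmless in Above, as 1 < 1 fails);
  -- excluded middle serves only to locate the cut.
  infimum : ExcludedMiddle 0ℓ → ℝ
  infimum em = record
    { L           = Below
    ; U           = Above
    ; L-inhabited = 0ℚ , 1ℚ , ℚ.positive⁻¹ 1ℚ , ℚ.nonNegative⁻¹ 1ℚ , 1^n≤a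
    ; U-inhabited = above-exists 1
    ; L-lower     = λ q<q′ (r , q′<r , h) → r , ℚ.<-trans q<q′ q′<r , h
    ; U-upper     = λ q<q′ (n , 0<q , h) → n , ℚ.<-trans 0<q q<q′ , ℚ.<-≤-trans h (^-mono-≤ n (ℚ.<⇒≤ 0<q) (ℚ.<⇒≤ q<q′))
    ; L-open      = λ (r , q<r , h) → let (m , q<m , m<r) = ℚ.<-dense q<r in m , q<m , r , m<r , h
    ; U-open      = λ (n , 0<r , h) → let (q , 0<q , q<r , h′) = ^-decrease n 0<r h in q , q<r , n , 0<q , h′
    ; disjoint    = λ ((r , q<r , _ , below) , n , 0<q , above) → ℚ.<-irrefl refl
        (ℚ.<-≤-trans above (ℚ.≤-trans (^-mono-≤ n (ℚ.<⇒≤ 0<q) (ℚ.<⇒≤ q<r)) (below n)))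
    ; located     = λ {q} {r} q<r → locate q<r em (0ℚ ℚ.<? r)
    }
    where
    above-exists : ∀ n .{{_ : NonZero n}} → ∃ Above
    above-exists n =
      let q , 0<q , an<q^n = U-inhabited (growth n)
      in  q , n , 0<q , subst (λ b → ℕ→ℚ b < q ^ℚ n) (ℕ.^-identityʳ (a n)) an<q^n

    -- If `r` is not above, then `r^n ≤ a n` for all `n`, so a positive `r` is itself the witness
    -- for `q`. For `r ≤ 0` the witness is 1, because `a n ≥ 1`.
    locate : ∀ {q r} → q < r → Dec (Above r) → Dec (0ℚ < r) → Below q ⊎ Above r
    locate q<r (yes above) _        = inj₂ above
    locate {r = r} q<r (no ¬above) (yes 0<r) =
      inj₁ (r , q<r , ℚ.<⇒≤ 0<r , λ n → ℚ.≮⇒≥ λ h → ¬above (n , 0<r , h))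
    locate q<r (no _) (no 0≮r) =
      inj₁ (1ℚ , ℚ.<-≤-trans q<r (ℚ.≤-trans (ℚ.≮⇒≥ 0≮r) (ℚ.nonNegative⁻¹ 1ℚ)) , ℚ.nonNegative⁻¹ 1ℚ , 1^n≤a)

  below⇒L-growth : ∀ n .{{_ : NonZero n}} {q} → Below q → L (growth n) q
  below⇒L-growth n {q} (r , q<r , _ , r^n≤a) = by-sign (q ℚ.<? 0ℚ)
    where
    by-sign : Dec (q < 0ℚ) → L (growth n) q
    by-sign (yes q<0) = inj₁ q<0
    by-sign (no  q≮0) = inj₂ (ℚ.<-≤-trans (^-mono-< n (ℚ.≮⇒≥ q≮0) q<r)
      (subst (λ b → r ^ℚ n ≤ ℕ→ℚ b) (sym (ℕ.^-identityʳ (a n))) (r^n≤a n)))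

  -- One index `m` with `a m < u^m` bounds every `a n` by `3^m u^n`; the gap between `u` and `t`
  -- absorbs the constant for large `n`.
  growth-upper : ∀ {u t} → Above u → u < t → ∃[ N ] (∀ n .{{_ : NonZero n}} → N ℕ.≤ n → U (growth n) t)
  growth-upper {u} {t} (m , 0<u , am<u^m) u<t =
    let N , dominates = exponential-dominates (ℕ→ℚ (3 ℕ.^ m)) 0<u u<t
    in  N , λ n N≤n → ℚ.<-trans 0<u u<t ,
          subst (λ b → ℕ→ℚ b < t ^ℚ n) (sym (ℕ.^-identityʳ (a n)))
            (ℚ.≤-<-trans (a≤3^m*u^n m 0<u am<u^m n) (dominates n N≤n))
    where
    instance
      m≢0 : NonZero m
      m≢0 = ℕ.≢-nonZero λ { refl → ℚ.<-irrefl refl am<u^m }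

  -- The rational `t` separates `growth n` from the infimum plus `ε`, since `t - ε = q` lies below
  -- the infimum. The rational `u` separates the infimum from `growth n` plus `ε`, since `u - ε < q`
  -- lies below every term.
  growth-close : ∀ (em : ExcludedMiddle 0ℓ) ε {q u t} → Below q → Above u → u < t → t - ε ≡ q →
                 ∃[ N ] (∀ n .{{_ : NonZero n}} → N ℕ.≤ n → ∣ growth n - infimum em ∣< ε)
  growth-close em ε {q} {u} {t} below above u<t t-ε≡q =
    let N , upper = growth-upper {u} {t} above u<t
    in  N , λ n N≤n →
          (t , upper n N≤n , subst Below (sym t-ε≡q) below) ,
          (u , above , below⇒L-growth n {u - ε} (L-lower (infimum em) u-ε<q below))
    where
    u-ε<q : u - ε < q
    u-ε<q = subst (u - ε <_) t-ε≡q (ℚ.+-monoˡ-< (- ε) u<t)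

  growth⟶infimum : (em : ExcludedMiddle 0ℓ) → growth ⟶ infimum em
  growth⟶infimum em ε 0<ε =
    let q , q∈L , u∈U = approximate μ {δ} 0<δ
        u = q + (δ + δ)
    in  growth-close em ε {q} {u} {u + δ} q∈L u∈U (p<p+δ u) (t-ε≡q q)
    where
    μ = infimum em
    -- Of the three thirds of `ε`, `approximate` uses two to bracket the infimum between `q` and
    -- `u`; the last puts `t` strictly above `u`.
    ⅓ = + 1 ℚ./ 3
    δ = ε * ⅓
    0<δ : 0ℚ < δ
    0<δ = subst (_< δ) (ℚ.*-zeroˡ ⅓) (*-mono-<ˡ (ℚ.positive⁻¹ ⅓) 0<ε)
    p<p+δ : ∀ p → p < p + δ
    p<p+δ p = subst (_< p + δ) (ℚ.+-identityʳ p) (ℚ.+-monoʳ-< p 0<δ)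
    3δ≡ε : δ + δ + δ ≡ ε
    3δ≡ε = begin
      δ + δ + δ            ≡⟨ cong (_+ δ) (ℚ.*-distribˡ-+ ε ⅓ ⅓) ⟨
      ε * (⅓ + ⅓) + δ      ≡⟨ ℚ.*-distribˡ-+ ε (⅓ + ⅓) ⅓ ⟨
      ε * 1ℚ               ≡⟨ ℚ.*-identityʳ ε ⟩
      ε                    ∎
      where open ≡-Reasoning
    t-ε≡q : ∀ q → q + (δ + δ) + δ - ε ≡ q
    t-ε≡q q = begin
      q + (δ + δ) + δ - ε  ≡⟨ cong (_- ε) (ℚ.+-assoc q (δ + δ) δ) ⟩
      q + (δ + δ + δ) - ε  ≡⟨ cong (λ e → q + e - ε) 3δ≡ε ⟩
      q + ε - ε            ≡⟨ //-rightDividesʳ ε q ⟩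
      q                    ∎
      where open ≡-Reasoning

open Growth using (2^[n/17]≤a; 2^[1/17]≤limit; infimum; growth⟶infimum)
open import Data.Product using (_,_)

mainTheorem1 : (∀ n → 2 ^[ n / 17 ] ≤ᴿ fromℕ (a n))
    × (∀ μ → growth ⟶ μ → 2 ^[ 1 / 17 ] ≤ᴿ μ)
    × (ExcludedMiddle 0ℓ → ∃ λ μ → growth ⟶ μ)
mainTheorem1 = 2^[n/17]≤a , 2^[1/17]≤limit , λ em → infimum em , growth⟶infimum em
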